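{- There exist instances of the single-machine problem in the context for which $\mathsf{Opt}=\Omega(\log P)\cdot\mathsf{Opt}(\mathrm{LP})$, where $P$ is the ratio between the largest and smallest processing times of jobs in an optimal solution; i.e., the linear program has integrality gap $\Omega(\log P)$.
   Context: Instance: a single machine and $n$ jobs; job $j$ has integer release date $r_j$ and integer processing time $p_j>0$; all profits are $1$. Given $\Pi>0$, one selects a set $S$ of jobs with $|S|\ge\Pi$ and a preemptive schedule of $S$ (no processing before release dates) minimizing $\sum_{j\in S}(C_j-r_j)$; $\mathsf{Opt}$ denotes this minimum. Let $\widetilde p_j$ be $p_j$ rounded up to the next power of $2$, and $T$ an upper bound on the time by which an optimal schedule completes. The linear program (LP) has variables $x_{jt}$ ($0\le t\le T$), $y_j$, $f_j$ and is: minimize $\sum_j f_j$ subject to (1) $f_j=\sum_{t=0}^T\big(\frac{x_{jt}}{\widetilde p_j}(t+\tfrac12-r_j)+\frac{x_{jt}}2\big)$ for all $j$; (2) $p_jy_j=\sum_{t=0}^Tx_{jt}$ for all $j$; (3) $\sum_jx_{jt}\le1$ for all $t$; (4) $\sum_jy_j\ge\Pi$; (5) $x_{jt}=0$ whenever $t<r_j$; (6) $x_{jt}\ge0$, $0\le y_j\le1$. $\mathsf{Opt}(\mathrm{LP})$ is its optimal value. -}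

module Defs where

open import Data.Nat as ℕ using (ℕ; zero; suc; _^_)
open import Data.Nat.Logarithm using (⌈log₂_⌉)
open import Data.Integer using (+_)
open import Data.Fin using (Fin; toℕ; _≟_)
open import Data.Bool using (Bool; true; false; if_then_else_)
open import Data.List using (List; length; lookup; foldr)
open import Data.Rational using (ℚ; 0ℚ; 1ℚ; ½; _+_; _*_; _-_; _⊔_; _≤_; _<_; _/_)
open import Data.Product using (Σ; ∃; ∃-syntax; _×_)
open import Data.Sum using (_⊎_)
open import Relation.Nullary using (¬_; does)
open import Relation.Binary.PropositionalEquality using (_≡_)

ℕtoℚ : ℕ → ℚ
ℕtoℚ n = + n / 1

sumℚ : (n : ℕ) → (Fin n → ℚ) → ℚ
sumℚ zero    f = 0ℚ
sumℚ (suc n) f = f Data.Fin.zero + sumℚ n (λ i → f (Data.Fin.suc i))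

sumℕ : (n : ℕ) → (Fin n → ℕ) → ℕ
sumℕ zero    f = 0
sumℕ (suc n) f = f Data.Fin.zero ℕ.+ sumℕ n (λ i → f (Data.Fin.suc i))

invPow2 : ℕ → ℚ
invPow2 zero    = 1ℚ
invPow2 (suc k) = ½ * invPow2 k

-- p̃ = p rounded up to the next power of 2 = 2 ^ ⌈log₂ p⌉ ; we need 1 / p̃
inv-p̃ : ℕ → ℚ
inv-p̃ p = invPow2 ⌈log₂ p ⌉

-- An instance: n jobs, release dates r, processing times p > 0 (all profits 1),
-- and the demand Π > 0.
record Instance : Set where
  field
    n     : ℕ
    r     : Fin n → ℕ
    p     : Fin n → ℕ
    p-pos : ∀ j → 1 ℕ.≤ p j
    Π     : ℕ
    Π-pos : 1 ℕ.≤ Π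

record Piece (n : ℕ) : Set where
  constructor piece
  field
    job   : Fin n
    start : ℚ
    end   : ℚ

-- A solution: a selected set S of jobs and a preemptive schedule given as a
-- finite list of processing pieces.
record Solution (I : Instance) : Set where
  field
    S      : Fin (Instance.n I) → Bool
    pieces : List (Piece (Instance.n I))

module _ {I : Instance} (σ : Solution I) where
  open Instance I
  open Solution σ

  processed : Fin n → ℚ
  processed j = foldr (λ pc acc → if does (Piece.job pc ≟ j)
                                    then (Piece.end pc - Piece.start pc) + acc
                                    else acc) 0ℚ pieces

  completion : Fin n → ℚ
  completion j = foldr (λ pc acc → if does (Piece.job pc ≟ j)
                                     then Piece.end pc ⊔ acc
                                     else acc) 0ℚ pieces

  cost : ℚ
  cost = sumℚ n (λ j → if S j then completion j - ℕtoℚ (r j) else 0ℚ)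

  card : ℕ
  card = sumℕ n (λ j → if S j then 1 else 0)

  record Valid : Set where
    field
      piece-ok   : ∀ (i : Fin (length pieces)) →
                     let pc = lookup pieces i in
                     (Piece.start pc < Piece.end pc)
                     × (ℕtoℚ (r (Piece.job pc)) ≤ Piece.start pc)
                     × (S (Piece.job pc) ≡ true)
      disjoint   : ∀ (i i' : Fin (length pieces)) → ¬ (i ≡ i') →
                     (Piece.end (lookup pieces i) ≤ Piece.start (lookup pieces i'))
                     ⊎ (Piece.end (lookup pieces i') ≤ Piece.start (lookup pieces i))
      full       : ∀ j → S j ≡ true → processed j ≡ ℕtoℚ (p j)
      enough     : Π ℕ.≤ card

  CompletesBy : ℕ → Set
  CompletesBy T = ∀ (i : Fin (length pieces)) → Piece.end (lookup pieces i) ≤ ℕtoℚ T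

  -- P = (largest p_j)/(smallest p_j) over j ∈ S satisfies 2^k ≤ P < 2^(k+1)
  LogRatio : ℕ → Set
  LogRatio k = ∃[ jmin ] ∃[ jmax ]
      (S jmin ≡ true) × (S jmax ≡ true)
    × (∀ j → S j ≡ true → (p jmin ℕ.≤ p j) × (p j ℕ.≤ p jmax))
    × (2 ^ k ℕ.* p jmin ℕ.≤ p jmax)
    × (p jmax ℕ.< 2 ^ suc k ℕ.* p jmin)

Optimal : {I : Instance} → Solution I → Set
Optimal {I} σ = Valid σ × (∀ (σ' : Solution I) → Valid σ' → cost σ ≤ cost σ')

record LPPoint (I : Instance) (T : ℕ) : Set where
  field
    x : Fin (Instance.n I) → Fin (suc T) → ℚ
    y : Fin (Instance.n I) → ℚ
    f : Fin (Instance.n I) → ℚ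

module _ {I : Instance} {T : ℕ} (sol : LPPoint I T) where
  open Instance I
  open LPPoint sol

  LPobjective : ℚ
  LPobjective = sumℚ n f

  record LPFeasible : Set where
    field
      c1 : ∀ j → f j ≡ sumℚ (suc T) (λ t →
              x j t * inv-p̃ (p j) * ((ℕtoℚ (toℕ t) + ½) - ℕtoℚ (r j)) + x j t * ½)
      c2 : ∀ j → ℕtoℚ (p j) * y j ≡ sumℚ (suc T) (λ t → x j t)
      c3 : ∀ t → sumℚ n (λ j → x j t) ≤ 1ℚ
      c4 : ℕtoℚ Π ≤ sumℚ n y
      c5 : ∀ j t → toℕ t ℕ.< r j → x j t ≡ 0ℚ
      c6 : ∀ j t → 0ℚ ≤ x j t
      c7 : ∀ j → (0ℚ ≤ y j) × (y j ≤ 1ℚ)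

module Submission where

{-
  There are 2D long jobs, of sizes 2, 4, …, 2^(2D), the job of size p being released at E - p, where
  E = 2^(2D), followed by E unit jobs released at E, E + 1, …; the demand is E + D.  Fractionally, each
  long job can be half processed before the next shorter one is released, which amounts to D jobs
  and leaves the machine free for the unit jobs, so the LP value is O(E).  Integrally, a set of long jobs
  completed by time τ has total size at most τ - E plus its largest member, so only one of them can
  be completed before the unit jobs and the others wait for time E each: the cost is at least D E.

  Exact optimality of a schedule: by interval packing the (c+1)-st completion of any schedule is no
  earlier than E plus the total size of the c shortest jobs.  Selecting the E + D shortest jobs attains
  all these bounds at once, and these are also the jobs with the latest release dates.
-}

open import Defs
open import Data.Nat as ℕ using (ℕ; zero; suc)
import Data.Nat.Properties as ℕₚ
open import Data.Nat.Logarithm using (⌈log₂2^n⌉≡n)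
open import Data.Nat.Solver using () renaming (module +-*-Solver to ℕ-Solver)
import Data.Integer as ℤ
import Data.Integer.Properties as ℤₚ
open import Data.Rational using (ℚ; 0ℚ; 1ℚ; ½; _+_; _*_; _-_; -_; _⊔_; _≤_; _<_; _≤?_; _/_; toℚᵘ; NonNegative; nonNegative; *<*; *≤*)
import Data.Rational.Properties as ℚₚ
import Data.Rational.Unnormalised as ℚᵘ
import Data.Rational.Unnormalised.Properties as ℚᵘₚ
open import Data.Rational.Solver using (module +-*-Solver)
open import Data.Fin as Fin using (Fin; toℕ; _↑ˡ_)
import Data.Fin.Properties as Finₚ
open import Data.Bool using (Bool; true; false; if_then_else_)
open import Data.Bool.Properties using (T-≡)
open import Data.List using (List; []; _∷_; length; lookup; foldr; tabulate)
open import Data.List.Properties using (length-tabulate)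
open import Data.Product using (∃; ∃-syntax; _×_; _,_; proj₁; proj₂)
open import Data.Sum using (_⊎_; inj₁; inj₂; [_,_]′)
open import Function using (_∘_; flip)
open import Function.Bundles using (Equivalence)
open import Relation.Nullary using (¬_; Dec; yes; no; contradiction; does)
open import Relation.Nullary.Decidable using (dec-true; dec-false; _×-dec_)
open import Relation.Binary.Definitions using (Total; Transitive; tri<; tri≈; tri>)
open import Relation.Binary.PropositionalEquality

-- Rational arithmetic and finite sums

ιᵘ : ℕ → ℚᵘ.ℚᵘ
ιᵘ n = ℚᵘ.mkℚᵘ (ℤ.+ n) 0

toℚᵘ-ℕtoℚ : ∀ n → toℚᵘ (ℕtoℚ n) ℚᵘ.≃ ιᵘ n
toℚᵘ-ℕtoℚ n = ℚₚ.toℚᵘ-fromℚᵘ (ιᵘ n)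

ℕtoℚ-homo-+ : ∀ m n → ℕtoℚ (m ℕ.+ n) ≡ ℕtoℚ m + ℕtoℚ n
ℕtoℚ-homo-+ m n = ℚₚ.toℚᵘ-injective (begin-equality
  toℚᵘ (ℕtoℚ (m ℕ.+ n))                  ≃⟨ toℚᵘ-ℕtoℚ (m ℕ.+ n) ⟩
  ιᵘ (m ℕ.+ n)                           ≃⟨ ℚᵘ.*≡* (cong (ℤ._* ℤ.1ℤ) (cong₂ ℤ._+_ (sym (ℤₚ.*-identityʳ (ℤ.+ m))) (sym (ℤₚ.*-identityʳ (ℤ.+ n))))) ⟩
  ιᵘ m ℚᵘ.+ ιᵘ n                         ≃⟨ ℚᵘₚ.+-cong (toℚᵘ-ℕtoℚ m) (toℚᵘ-ℕtoℚ n) ⟨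
  toℚᵘ (ℕtoℚ m) ℚᵘ.+ toℚᵘ (ℕtoℚ n)       ≃⟨ ℚₚ.toℚᵘ-homo-+ (ℕtoℚ m) (ℕtoℚ n) ⟨
  toℚᵘ (ℕtoℚ m + ℕtoℚ n)                 ∎)
  where open ℚᵘₚ.≤-Reasoning

ℕtoℚ-homo-* : ∀ m n → ℕtoℚ (m ℕ.* n) ≡ ℕtoℚ m * ℕtoℚ n
ℕtoℚ-homo-* m n = ℚₚ.toℚᵘ-injective (begin-equality
  toℚᵘ (ℕtoℚ (m ℕ.* n))                  ≃⟨ toℚᵘ-ℕtoℚ (m ℕ.* n) ⟩
  ιᵘ (m ℕ.* n)                           ≃⟨ ℚᵘ.*≡* (cong (ℤ._* ℤ.1ℤ) (ℤₚ.pos-* m n)) ⟩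
  ιᵘ m ℚᵘ.* ιᵘ n                         ≃⟨ ℚᵘₚ.*-cong (toℚᵘ-ℕtoℚ m) (toℚᵘ-ℕtoℚ n) ⟨
  toℚᵘ (ℕtoℚ m) ℚᵘ.* toℚᵘ (ℕtoℚ n)       ≃⟨ ℚₚ.toℚᵘ-homo-* (ℕtoℚ m) (ℕtoℚ n) ⟨
  toℚᵘ (ℕtoℚ m * ℕtoℚ n)                 ∎)
  where open ℚᵘₚ.≤-Reasoning

ℕtoℚ-mono-≤ : ∀ {m n} → m ℕ.≤ n → ℕtoℚ m ≤ ℕtoℚ n
ℕtoℚ-mono-≤ {m} {n} m≤n = ℚₚ.toℚᵘ-cancel-≤ (begin
  toℚᵘ (ℕtoℚ m)  ≃⟨ toℚᵘ-ℕtoℚ m ⟩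
  ιᵘ m           ≤⟨ ℚᵘ.*≤* (ℤₚ.*-monoʳ-≤-nonNeg ℤ.1ℤ (ℤ.+≤+ m≤n)) ⟩
  ιᵘ n           ≃⟨ toℚᵘ-ℕtoℚ n ⟨
  toℚᵘ (ℕtoℚ n)  ∎)
  where open ℚᵘₚ.≤-Reasoning

ℕtoℚ-mono-< : ∀ {m n} → m ℕ.< n → ℕtoℚ m < ℕtoℚ n
ℕtoℚ-mono-< {m} {n} m<n = ℚₚ.toℚᵘ-cancel-< (begin-strict
  toℚᵘ (ℕtoℚ m)  ≃⟨ toℚᵘ-ℕtoℚ m ⟩
  ιᵘ m           <⟨ ℚᵘ.*<* (ℤₚ.*-monoʳ-<-pos ℤ.1ℤ (ℤ.+<+ m<n)) ⟩
  ιᵘ n           ≃⟨ toℚᵘ-ℕtoℚ n ⟨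
  toℚᵘ (ℕtoℚ n)  ∎)
  where open ℚᵘₚ.≤-Reasoning

0≤ℕtoℚ : ∀ n → 0ℚ ≤ ℕtoℚ n
0≤ℕtoℚ n = ℕtoℚ-mono-≤ {0} {n} ℕ.z≤n

p+s≤r+q⇒p-q≤r-s : ∀ p q r s → p + s ≤ r + q → p - q ≤ r - s
p+s≤r+q⇒p-q≤r-s p q r s h = begin
  p - q                ≡⟨ solve 3 (λ p q s → p :- q := (p :+ s) :- (q :+ s)) refl p q s ⟩
  (p + s) - (q + s)    ≤⟨ ℚₚ.+-monoˡ-≤ (- (q + s)) h ⟩
  (r + q) - (q + s)    ≡⟨ solve 3 (λ r q s → (r :+ q) :- (q :+ s) := r :- s) refl r q s ⟩
  r - s                ∎
  where open ℚₚ.≤-Reasoning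
        open +-*-Solver

p≤q-r⇒r+p≤q : ∀ {p q r} → p ≤ q - r → r + p ≤ q
p≤q-r⇒r+p≤q {p} {q} {r} h = subst (r + p ≤_) (solve 2 (λ q r → r :+ (q :- r) := q) refl q r) (ℚₚ.+-monoʳ-≤ r h)
  where open +-*-Solver

sumℚ-cong : ∀ n {f g : Fin n → ℚ} → (∀ i → f i ≡ g i) → sumℚ n f ≡ sumℚ n g
sumℚ-cong zero    f≗g = refl
sumℚ-cong (suc n) f≗g = cong₂ _+_ (f≗g Fin.zero) (sumℚ-cong n (f≗g ∘ Fin.suc))

sumℚ-mono-≤ : ∀ n {f g : Fin n → ℚ} → (∀ i → f i ≤ g i) → sumℚ n f ≤ sumℚ n g
sumℚ-mono-≤ zero    f≤g = ℚₚ.≤-refl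
sumℚ-mono-≤ (suc n) f≤g = ℚₚ.+-mono-≤ (f≤g Fin.zero) (sumℚ-mono-≤ n (f≤g ∘ Fin.suc))

sumℚ-0 : ∀ n → sumℚ n (λ _ → 0ℚ) ≡ 0ℚ
sumℚ-0 zero    = refl
sumℚ-0 (suc n) = trans (ℚₚ.+-identityˡ _) (sumℚ-0 n)

sumℚ-+ : ∀ n (f g : Fin n → ℚ) → sumℚ n (λ i → f i + g i) ≡ sumℚ n f + sumℚ n g
sumℚ-+ zero    f g = refl
sumℚ-+ (suc n) f g = trans (cong (f Fin.zero + g Fin.zero +_) (sumℚ-+ n (f ∘ Fin.suc) (g ∘ Fin.suc)))
  (solve 4 (λ a b c d → (a :+ b) :+ (c :+ d) := (a :+ c) :+ (b :+ d)) refl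
    (f Fin.zero) (g Fin.zero) (sumℚ n (f ∘ Fin.suc)) (sumℚ n (g ∘ Fin.suc)))
  where open +-*-Solver

sumℚ-*ˡ : ∀ n c (f : Fin n → ℚ) → sumℚ n (λ i → c * f i) ≡ c * sumℚ n f
sumℚ-*ˡ zero    c f = sym (ℚₚ.*-zeroʳ c)
sumℚ-*ˡ (suc n) c f = trans (cong (c * f Fin.zero +_) (sumℚ-*ˡ n c (f ∘ Fin.suc)))
  (sym (ℚₚ.*-distribˡ-+ c (f Fin.zero) _))

sumℚ-swap : ∀ m n (f : Fin m → Fin n → ℚ) →
            sumℚ m (λ i → sumℚ n (f i)) ≡ sumℚ n (λ j → sumℚ m (λ i → f i j))
sumℚ-swap zero    n f = sym (sumℚ-0 n)
sumℚ-swap (suc m) n f = trans (cong (sumℚ n (f Fin.zero) +_) (sumℚ-swap m n (f ∘ Fin.suc)))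
  (sym (sumℚ-+ n (f Fin.zero) _))

sumℚ-ℕtoℚ : ∀ n (f : Fin n → ℕ) → sumℚ n (ℕtoℚ ∘ f) ≡ ℕtoℚ (sumℕ n f)
sumℚ-ℕtoℚ zero    f = refl
sumℚ-ℕtoℚ (suc n) f = trans (cong (ℕtoℚ (f Fin.zero) +_) (sumℚ-ℕtoℚ n (f ∘ Fin.suc)))
  (sym (ℕtoℚ-homo-+ (f Fin.zero) _))

sumℚ-const : ∀ n c → sumℚ n (λ _ → c) ≡ ℕtoℚ n * c
sumℚ-const zero    c = sym (ℚₚ.*-zeroˡ c)
sumℚ-const (suc n) c = begin
  c + sumℚ n (λ _ → c)  ≡⟨ cong (c +_) (sumℚ-const n c) ⟩
  c + ℕtoℚ n * c        ≡⟨ solve 2 (λ c n → c :+ n :* c := (con 1ℚ :+ n) :* c) refl c (ℕtoℚ n) ⟩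
  (1ℚ + ℕtoℚ n) * c     ≡⟨ cong (_* c) (ℕtoℚ-homo-+ 1 n) ⟨
  ℕtoℚ (suc n) * c      ∎
  where open ≡-Reasoning
        open +-*-Solver

-- The summand is a function on ℕ composed with `toℕ`, so the shifted second block can be described
-- without casts between `Fin` types.
sumℚ-++ : ∀ m n (F : ℕ → ℚ) →
          sumℚ (m ℕ.+ n) (F ∘ toℕ) ≡ sumℚ m (F ∘ toℕ) + sumℚ n (λ i → F (m ℕ.+ toℕ i))
sumℚ-++ zero    n F = sym (ℚₚ.+-identityˡ _)
sumℚ-++ (suc m) n F = trans (cong (F 0 +_) (sumℚ-++ m n (F ∘ suc))) (sym (ℚₚ.+-assoc (F 0) _ _))

sumℕ-cong : ∀ n {f g : Fin n → ℕ} → (∀ i → f i ≡ g i) → sumℕ n f ≡ sumℕ n g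
sumℕ-cong zero    f≗g = refl
sumℕ-cong (suc n) f≗g = cong₂ ℕ._+_ (f≗g Fin.zero) (sumℕ-cong n (f≗g ∘ Fin.suc))

sumℕ-mono-≤ : ∀ n {f g : Fin n → ℕ} → (∀ i → f i ℕ.≤ g i) → sumℕ n f ℕ.≤ sumℕ n g
sumℕ-mono-≤ zero    f≤g = ℕ.z≤n
sumℕ-mono-≤ (suc n) f≤g = ℕₚ.+-mono-≤ (f≤g Fin.zero) (sumℕ-mono-≤ n (f≤g ∘ Fin.suc))

sumℕ-++ : ∀ m n (F : ℕ → ℕ) →
          sumℕ (m ℕ.+ n) (F ∘ toℕ) ≡ sumℕ m (F ∘ toℕ) ℕ.+ sumℕ n (λ i → F (m ℕ.+ toℕ i))
sumℕ-++ zero    n F = refl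
sumℕ-++ (suc m) n F = trans (cong (F 0 ℕ.+_) (sumℕ-++ m n (F ∘ suc))) (sym (ℕₚ.+-assoc (F 0) _ _))

sumℕ-snoc : ∀ n (F : ℕ → ℕ) → sumℕ (suc n) (F ∘ toℕ) ≡ sumℕ n (F ∘ toℕ) ℕ.+ F n
sumℕ-snoc zero    F = ℕₚ.+-comm (F 0) 0
sumℕ-snoc (suc n) F = trans (cong (F 0 ℕ.+_) (sumℕ-snoc n (F ∘ suc))) (sym (ℕₚ.+-assoc (F 0) _ _))

sumℕ-const : ∀ n c → sumℕ n (λ _ → c) ≡ n ℕ.* c
sumℕ-const zero    c = refl
sumℕ-const (suc n) c = cong (c ℕ.+_) (sumℕ-const n c)

sumℕ-gap : ∀ n {f g : Fin n → ℕ} c → (∀ i → f i ℕ.+ c ℕ.≤ g i) → sumℕ n f ℕ.+ n ℕ.* c ℕ.≤ sumℕ n g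
sumℕ-gap zero    c f+c≤g = ℕ.z≤n
sumℕ-gap (suc n) {f} c f+c≤g = ℕₚ.≤-trans (ℕₚ.≤-reflexive
  (solve 4 (λ a s c m → a :+ s :+ (c :+ m) := a :+ c :+ (s :+ m)) refl (f Fin.zero) (sumℕ n (f ∘ Fin.suc)) c (n ℕ.* c)))
  (ℕₚ.+-mono-≤ (f+c≤g Fin.zero) (sumℕ-gap n c (f+c≤g ∘ Fin.suc)))
  where open ℕ-Solver

sumℕ-prefix-mono : ∀ (F : ℕ → ℕ) {m n} → m ℕ.≤ n → sumℕ m (F ∘ toℕ) ℕ.≤ sumℕ n (F ∘ toℕ)
sumℕ-prefix-mono F {m} m≤n with ℕₚ.m≤n⇒∃[o]m+o≡n m≤n
... | d , refl = subst (sumℕ m (F ∘ toℕ) ℕ.≤_) (sym (sumℕ-++ m d F)) (ℕₚ.m≤m+n _ _)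

-- Sums over subsets

sumOnℕ : ∀ {n} → (Fin n → Bool) → (Fin n → ℕ) → ℕ
sumOnℕ {n} K f = sumℕ n (λ j → if K j then f j else 0)

sumOn : ∀ {n} → (Fin n → Bool) → (Fin n → ℚ) → ℚ
sumOn {n} K f = sumℚ n (λ j → if K j then f j else 0ℚ)

count : ∀ {n} → (Fin n → Bool) → ℕ
count K = sumOnℕ K (λ _ → 1)

infixl 6 _∖_
_∖_ : ∀ {n} → (Fin n → Bool) → Fin n → Fin n → Bool
(K ∖ m) j = if does (j Fin.≟ m) then false else K j

∖-⊆ : ∀ {n} (K : Fin n → Bool) m j → (K ∖ m) j ≡ true → K j ≡ true
∖-⊆ K m j j∈ with does (j Fin.≟ m)
∖-⊆ K m j () | true
∖-⊆ K m j j∈ | false = j∈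

sumOnℕ-remove : ∀ {n} (K : Fin n → Bool) (f : Fin n → ℕ) m → K m ≡ true →
                sumOnℕ K f ≡ f m ℕ.+ sumOnℕ (K ∖ m) f
sumOnℕ-remove K f Fin.zero    m∈ rewrite m∈ = refl
sumOnℕ-remove K f (Fin.suc m) m∈ = begin
  k₀ ℕ.+ sumOnℕ (K ∘ Fin.suc) (f ∘ Fin.suc) ≡⟨ cong (k₀ ℕ.+_) (sumOnℕ-remove (K ∘ Fin.suc) (f ∘ Fin.suc) m m∈) ⟩
  k₀ ℕ.+ (f (Fin.suc m) ℕ.+ rest)           ≡⟨ ℕₚ.+-assoc k₀ _ rest ⟨
  k₀ ℕ.+ f (Fin.suc m) ℕ.+ rest             ≡⟨ cong (ℕ._+ rest) (ℕₚ.+-comm k₀ _) ⟩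
  f (Fin.suc m) ℕ.+ k₀ ℕ.+ rest             ≡⟨ ℕₚ.+-assoc (f (Fin.suc m)) k₀ rest ⟩
  f (Fin.suc m) ℕ.+ (k₀ ℕ.+ rest)           ∎
  where
  open ≡-Reasoning
  k₀ rest : ℕ
  k₀ = if K Fin.zero then f Fin.zero else 0
  rest = sumOnℕ (K ∘ Fin.suc ∖ m) (f ∘ Fin.suc)

sumOn-remove : ∀ {n} (K : Fin n → Bool) (f : Fin n → ℚ) m → K m ≡ true →
               sumOn K f ≡ f m + sumOn (K ∖ m) f
sumOn-remove K f Fin.zero    m∈ rewrite m∈ = cong (f Fin.zero +_) (sym (ℚₚ.+-identityˡ _))
sumOn-remove K f (Fin.suc m) m∈ = begin
  k₀ + sumOn (K ∘ Fin.suc) (f ∘ Fin.suc) ≡⟨ cong (k₀ +_) (sumOn-remove (K ∘ Fin.suc) (f ∘ Fin.suc) m m∈) ⟩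
  k₀ + (f (Fin.suc m) + rest)            ≡⟨ ℚₚ.+-assoc k₀ _ rest ⟨
  k₀ + f (Fin.suc m) + rest              ≡⟨ cong (_+ rest) (ℚₚ.+-comm k₀ _) ⟩
  f (Fin.suc m) + k₀ + rest              ≡⟨ ℚₚ.+-assoc (f (Fin.suc m)) k₀ rest ⟩
  f (Fin.suc m) + (k₀ + rest)            ∎
  where
  open ≡-Reasoning
  k₀ rest : ℚ
  k₀ = if K Fin.zero then f Fin.zero else 0ℚ
  rest = sumOn (K ∘ Fin.suc ∖ m) (f ∘ Fin.suc)

-- The subset has the form of the selection in `schedule`; `_<ᵇ_` computes along `toℕ`, so each step
-- of the induction holds by reduction.
sumOnℕ-prefix : ∀ m d (F : ℕ → ℕ) →
                sumOnℕ {m ℕ.+ d} (λ j → toℕ j ℕ.<ᵇ m) (F ∘ toℕ) ≡ sumℕ m (F ∘ toℕ)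
sumOnℕ-prefix zero    d F = trans (sumℕ-const d 0) (ℕₚ.*-zeroʳ d)
sumOnℕ-prefix (suc m) d F = cong (F 0 ℕ.+_) (sumOnℕ-prefix m d (F ∘ suc))

sumOn-ℕtoℚ : ∀ {n} (K : Fin n → Bool) (f : Fin n → ℕ) →
             sumOn K (ℕtoℚ ∘ f) ≡ ℕtoℚ (sumOnℕ K f)
sumOn-ℕtoℚ {n} K f = trans (sumℚ-cong n (λ j → lem (K j) (f j))) (sumℚ-ℕtoℚ n _)
  where
  lem : ∀ b m → (if b then ℕtoℚ m else 0ℚ) ≡ ℕtoℚ (if b then m else 0)
  lem true  m = refl
  lem false m = refl

sumOn-- : ∀ {n} (K : Fin n → Bool) (f g : Fin n → ℚ) →
          sumOn K (λ j → f j - g j) ≡ sumOn K f - sumOn K g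
sumOn-- {n} K f g = begin
  sumOn K (λ j → f j - g j)                                ≡⟨ sumℚ-cong n (λ j → lem (K j) (f j) (g j)) ⟩
  sumℚ n (λ j → fK j + (- 1ℚ) * gK j)                      ≡⟨ sumℚ-+ n fK (λ j → (- 1ℚ) * gK j) ⟩
  sumOn K f + sumℚ n (λ j → (- 1ℚ) * gK j)                 ≡⟨ cong (sumOn K f +_) (sumℚ-*ˡ n (- 1ℚ) gK) ⟩
  sumOn K f + (- 1ℚ) * sumOn K g                           ≡⟨ solve 2 (λ a b → a :+ con (- 1ℚ) :* b := a :- b) refl (sumOn K f) (sumOn K g) ⟩
  sumOn K f - sumOn K g                                    ∎
  where
  open ≡-Reasoning
  open +-*-Solver
  fK gK : Fin n → ℚ
  fK j = if K j then f j else 0ℚ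
  gK j = if K j then g j else 0ℚ
  lem : ∀ b x y → (if b then x - y else 0ℚ) ≡ (if b then x else 0ℚ) + (- 1ℚ) * (if b then y else 0ℚ)
  lem true  x y = solve 2 (λ x y → x :- y := x :+ con (- 1ℚ) :* y) refl x y
  lem false x y = refl

sumOn-cong : ∀ {n} (K : Fin n → Bool) {f g : Fin n → ℚ} → (∀ j → K j ≡ true → f j ≡ g j) → sumOn K f ≡ sumOn K g
sumOn-cong {n} K {f} {g} f≗g = sumℚ-cong n (λ j → lem (K j) (f≗g j))
  where
  lem : ∀ b {x y : ℚ} → (b ≡ true → x ≡ y) → (if b then x else 0ℚ) ≡ (if b then y else 0ℚ)
  lem true  x≡y = x≡y refl
  lem false x≡y = refl

sumOn-0 : ∀ {n} (K : Fin n → Bool) → sumOn K (λ _ → 0ℚ) ≡ 0ℚ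
sumOn-0 {n} K = trans (sumℚ-cong n (λ j → lem (K j))) (sumℚ-0 n)
  where
  lem : ∀ b → (if b then 0ℚ else 0ℚ) ≡ 0ℚ
  lem true  = refl
  lem false = refl

sumOn-single : ∀ {n} (K : Fin n → Bool) m v →
               sumOn K (λ j → if does (m Fin.≟ j) then v else 0ℚ) ≡ (if K m then v else 0ℚ)
sumOn-single K Fin.zero v = trans (cong ((if K Fin.zero then v else 0ℚ) +_) (sumOn-0 (K ∘ Fin.suc))) (ℚₚ.+-identityʳ _)
sumOn-single K (Fin.suc m) v with K Fin.zero
... | true  = trans (ℚₚ.+-identityˡ _) (sumOn-single (K ∘ Fin.suc) m v)
... | false = trans (ℚₚ.+-identityˡ _) (sumOn-single (K ∘ Fin.suc) m v)

count-empty : ∀ {n} (K : Fin n → Bool) → (∀ j → K j ≡ false) → count K ≡ 0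
count-empty {zero}  K all-out = refl
count-empty {suc n} K all-out rewrite all-out Fin.zero = count-empty (K ∘ Fin.suc) (all-out ∘ Fin.suc)

count≡0⇒sumOn≡0 : ∀ {n} (K : Fin n → Bool) f → count K ≡ 0 → sumOn K f ≡ 0ℚ
count≡0⇒sumOn≡0 {zero}  K f eq = refl
count≡0⇒sumOn≡0 {suc n} K f eq with K Fin.zero
-- A member at zero would make the count a successor, so only this case remains.
... | false = trans (ℚₚ.+-identityˡ _) (count≡0⇒sumOn≡0 (K ∘ Fin.suc) (f ∘ Fin.suc) eq)

-- Maxima over subsets

module _ {A : Set} {_≲_ : A → A → Set} (total : Total _≲_) (≲-trans : Transitive _≲_) where

  private
    ≲-refl : ∀ x → x ≲ x
    ≲-refl x = [ (λ p → p) , (λ p → p) ]′ (total x x)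

  IsMaxOn : ∀ {n} → (Fin n → Bool) → (Fin n → A) → Fin n → Set
  IsMaxOn K f m = K m ≡ true × (∀ j → K j ≡ true → f j ≲ f m)

  -- The order is arbitrary because two are needed: the usual one on ℚ to find a job completed last,
  -- and the reversed one on ℕ to find a job released first.
  empty-or-max : ∀ {n} (K : Fin n → Bool) (f : Fin n → A) → (∀ j → K j ≡ false) ⊎ ∃ (IsMaxOn K f)
  empty-or-max {zero}  K f = inj₁ λ ()
  empty-or-max {suc n} K f with K Fin.zero in eq | empty-or-max (K ∘ Fin.suc) (f ∘ Fin.suc)
  ... | false | inj₁ none = inj₁ λ { Fin.zero → eq ; (Fin.suc j) → none j }
  ... | false | inj₂ (m , m∈ , max) = inj₂ (Fin.suc m , m∈ ,
        λ { Fin.zero 0∈ → contradiction (trans (sym eq) 0∈) λ () ; (Fin.suc j) j∈ → max j j∈ })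
  ... | true | inj₁ none = inj₂ (Fin.zero , eq ,
        λ { Fin.zero _ → ≲-refl _ ; (Fin.suc j) j∈ → contradiction (trans (sym (none j)) j∈) λ () })
  ... | true | inj₂ (m , m∈ , max) with total (f Fin.zero) (f (Fin.suc m))
  ...   | inj₁ 0≲m = inj₂ (Fin.suc m , m∈ , λ { Fin.zero _ → 0≲m ; (Fin.suc j) j∈ → max j j∈ })
  ...   | inj₂ m≲0 = inj₂ (Fin.zero , eq ,
        λ { Fin.zero _ → ≲-refl _ ; (Fin.suc j) j∈ → ≲-trans (max j j∈) m≲0 })

  max-on : ∀ {n} (K : Fin n → Bool) (f : Fin n → A) {c} → count K ≡ suc c → ∃ (IsMaxOn K f)
  max-on K f eq with empty-or-max K f
  ... | inj₁ none = contradiction (trans (sym (count-empty K none)) eq) λ ()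
  ... | inj₂ max  = max

-- Comparison of subsets with prefixes

prefix-≤-sumOnℕ : ∀ {n} (K : Fin n → Bool) (F : ℕ → ℕ) → (∀ {i j} → i ℕ.≤ j → F i ℕ.≤ F j) →
                  sumℕ (count K) (F ∘ toℕ) ℕ.≤ sumOnℕ K (F ∘ toℕ)
prefix-≤-sumOnℕ {zero}  K F mono = ℕ.z≤n
prefix-≤-sumOnℕ {suc n} K F mono with K Fin.zero
... | true  = ℕₚ.+-monoʳ-≤ (F 0) (prefix-≤-sumOnℕ (K ∘ Fin.suc) (F ∘ suc) (mono ∘ ℕ.s≤s))
-- Index 0 is absent, so every member moves up by one and `F ∘ suc` dominates `F` termwise.
... | false = ℕₚ.≤-trans (sumℕ-mono-≤ (count (K ∘ Fin.suc)) (λ i → mono (ℕₚ.n≤1+n (toℕ i))))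
                (prefix-≤-sumOnℕ (K ∘ Fin.suc) (F ∘ suc) (mono ∘ ℕ.s≤s))

-- Termwise comparison of ∑ (R j - θ) over K and over the prefix, with the subtractions moved across.
sumOnℕ-≤-prefix : ∀ {n} (K : Fin n → Bool) (R : ℕ → ℕ) Π θ →
                  (∀ j → j ℕ.< Π → θ ℕ.≤ R j) → (∀ j → Π ℕ.≤ j → R j ℕ.≤ θ) →
                  sumOnℕ K (R ∘ toℕ) ℕ.+ Π ℕ.* θ ℕ.≤ sumℕ Π (R ∘ toℕ) ℕ.+ count K ℕ.* θ
sumOnℕ-≤-prefix {zero} K R Π θ hi lo = ℕₚ.≤-trans (lem Π R hi) (ℕₚ.m≤m+n _ 0)
  where
  lem : ∀ Π (R : ℕ → ℕ) → (∀ j → j ℕ.< Π → θ ℕ.≤ R j) → Π ℕ.* θ ℕ.≤ sumℕ Π (R ∘ toℕ)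
  lem zero    R hi = ℕ.z≤n
  lem (suc Π) R hi = ℕₚ.+-mono-≤ (hi 0 (ℕ.s≤s ℕ.z≤n)) (lem Π (R ∘ suc) (λ j → hi (suc j) ∘ ℕ.s≤s))
sumOnℕ-≤-prefix {suc n} K R zero θ hi lo with K Fin.zero | sumOnℕ-≤-prefix (K ∘ Fin.suc) (R ∘ suc) zero θ (λ _ ()) (λ j _ → lo (suc j) ℕ.z≤n)
... | false | ih = ih
... | true  | ih = ℕₚ.≤-trans (ℕₚ.≤-reflexive (ℕₚ.+-assoc (R 0) _ 0)) (ℕₚ.+-mono-≤ (lo 0 ℕ.z≤n) ih)
sumOnℕ-≤-prefix {suc n} K R (suc Π) θ hi lo
  with K Fin.zero | sumOnℕ-≤-prefix (K ∘ Fin.suc) (R ∘ suc) Π θ (λ j → hi (suc j) ∘ ℕ.s≤s) (λ j → lo (suc j) ∘ ℕ.s≤s)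
... | false | ih = begin
  s ℕ.+ (θ ℕ.+ Π ℕ.* θ)  ≡⟨ solve 3 (λ s t u → s :+ (t :+ u) := t :+ (s :+ u)) refl s θ (Π ℕ.* θ) ⟩
  θ ℕ.+ (s ℕ.+ Π ℕ.* θ)  ≤⟨ ℕₚ.+-mono-≤ (hi 0 (ℕ.s≤s ℕ.z≤n)) ih ⟩
  R 0 ℕ.+ (t ℕ.+ v)      ≡⟨ ℕₚ.+-assoc (R 0) t v ⟨
  R 0 ℕ.+ t ℕ.+ v        ∎
  where
  open ℕₚ.≤-Reasoning
  open ℕ-Solver
  s = sumOnℕ (K ∘ Fin.suc) (R ∘ suc ∘ toℕ)
  t = sumℕ Π (R ∘ suc ∘ toℕ)
  v = count (K ∘ Fin.suc) ℕ.* θ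
... | true  | ih = begin
  R 0 ℕ.+ s ℕ.+ (θ ℕ.+ Π ℕ.* θ)    ≡⟨ solve 4 (λ r s t u → r :+ s :+ (t :+ u) := r :+ t :+ (s :+ u)) refl (R 0) s θ (Π ℕ.* θ) ⟩
  R 0 ℕ.+ θ ℕ.+ (s ℕ.+ Π ℕ.* θ)    ≤⟨ ℕₚ.+-monoʳ-≤ (R 0 ℕ.+ θ) ih ⟩
  R 0 ℕ.+ θ ℕ.+ (t ℕ.+ v)          ≡⟨ solve 4 (λ r th t v → r :+ th :+ (t :+ v) := r :+ t :+ (th :+ v)) refl (R 0) θ t v ⟩
  R 0 ℕ.+ t ℕ.+ (θ ℕ.+ v)          ∎
  where
  open ℕₚ.≤-Reasoning
  open ℕ-Solver
  s = sumOnℕ (K ∘ Fin.suc) (R ∘ suc ∘ toℕ)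
  t = sumℕ Π (R ∘ suc ∘ toℕ)
  v = count (K ∘ Fin.suc) ℕ.* θ

-- Removing a job that completes last turns the bound on the (c+1)-st completion time into one on the sum.
sum-of-order-statistics : ∀ {n} (C : Fin n → ℚ) (e : ℕ → ℕ) (K : Fin n → Bool) →
  (∀ K′ → (∀ j → K′ j ≡ true → K j ≡ true) → ∀ c → count K′ ≡ suc c →
     ∀ τ → (∀ j → K′ j ≡ true → C j ≤ τ) → ℕtoℚ (e c) ≤ τ) →
  ∀ c → count K ≡ c → ℕtoℚ (sumℕ c (e ∘ toℕ)) ≤ sumOn K C
sum-of-order-statistics C e K bound zero    |K|≡ = ℚₚ.≤-reflexive (sym (count≡0⇒sumOn≡0 K C |K|≡))
sum-of-order-statistics C e K bound (suc c) |K|≡ with max-on ℚₚ.≤-total ℚₚ.≤-trans K C |K|≡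
... | m , m∈ , max = begin
  ℕtoℚ (sumℕ (suc c) (e ∘ toℕ))          ≡⟨ cong ℕtoℚ (trans (sumℕ-snoc c e) (ℕₚ.+-comm _ (e c))) ⟩
  ℕtoℚ (e c ℕ.+ sumℕ c (e ∘ toℕ))        ≡⟨ ℕtoℚ-homo-+ (e c) _ ⟩
  ℕtoℚ (e c) + ℕtoℚ (sumℕ c (e ∘ toℕ))   ≤⟨ ℚₚ.+-mono-≤ (bound K (λ _ j∈ → j∈) c |K|≡ (C m) max)
                                              (sum-of-order-statistics C e (K ∖ m)
                                                 (λ K′ K′⊆ → bound K′ (λ j → ∖-⊆ K m j ∘ K′⊆ j)) c
                                                 (ℕₚ.suc-injective (trans (sym (sumOnℕ-remove K _ m m∈)) |K|≡))) ⟩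
  C m + sumOn (K ∖ m) C                  ≡⟨ sumOn-remove K C m m∈ ⟨
  sumOn K C                              ∎
  where open ℚₚ.≤-Reasoning

-- Packing of intervals

module _ {n : ℕ} where

  open Piece

  len : Piece n → ℚ
  len x = end x - start x

  -- Abstract, since a reduced `does` of a rational comparison is not recognised by with-abstraction.
  abstract
    inside? : ∀ a b (x : Piece n) → Dec (a ≤ start x × end x ≤ b)
    inside? a b x = (a ≤? start x) ×-dec (end x ≤? b)

  -- A piece counts with its full length if it lies wholly between a and b, and with 0 otherwise;
  -- pieces are never truncated at the ends.
  volumeIn : ℚ → ℚ → List (Piece n) → ℚ
  weightIn : ℚ → ℚ → Piece n → ℚ
  weightIn a b x = if does (inside? a b x) then len x else 0ℚ
  volumeIn a b []       = 0ℚ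
  volumeIn a b (x ∷ xs) = weightIn a b x + volumeIn a b xs

  Disjoint : Piece n → Piece n → Set
  Disjoint x y = (end x ≤ start y) ⊎ (end y ≤ start x)

  Nonneg : List (Piece n) → Set
  Nonneg xs = ∀ i → start (lookup xs i) ≤ end (lookup xs i)

  len≥0 : ∀ x → start x ≤ end x → 0ℚ ≤ len x
  len≥0 x s≤e = subst (_≤ len x) (ℚₚ.+-inverseʳ (start x)) (ℚₚ.+-monoˡ-≤ (- start x) s≤e)

  weightIn-inside : ∀ {a b} x → a ≤ start x → end x ≤ b → weightIn a b x ≡ len x
  weightIn-inside {a} {b} x a≤s e≤b =
    cong (if_then len x else 0ℚ) (dec-true (inside? a b x) (a≤s , e≤b))

  weightIn≥0 : ∀ a b x → start x ≤ end x → 0ℚ ≤ weightIn a b x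
  weightIn≥0 a b x s≤e with does (inside? a b x)
  ... | true  = len≥0 x s≤e
  ... | false = ℚₚ.≤-refl

  -- A piece y disjoint from x lies entirely before or entirely after x, so one of the two weights
  -- on the right already equals that of y; the other is nonnegative.
  weightIn-split : ∀ a b x y → start y ≤ end y → Disjoint x y →
                   weightIn a b y ≤ weightIn a (start x) y + weightIn (end x) b y
  weightIn-split a b x y s≤e dis with inside? a b y
  ... | no _ = ℚₚ.+-mono-≤ (weightIn≥0 a (start x) y s≤e) (weightIn≥0 (end x) b y s≤e)
  ... | yes (a≤s , e≤b) with dis
  ...   | inj₁ x<y = ℚₚ.≤-trans (ℚₚ.≤-reflexive (sym (ℚₚ.+-identityˡ _))) (ℚₚ.+-mono-≤ (weightIn≥0 a (start x) y s≤e)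
                       (ℚₚ.≤-reflexive (sym (weightIn-inside y x<y e≤b))))
  ...   | inj₂ y<x = ℚₚ.≤-trans (ℚₚ.≤-reflexive (sym (ℚₚ.+-identityʳ _))) (ℚₚ.+-mono-≤ (ℚₚ.≤-reflexive (sym (weightIn-inside y a≤s y<x)))
                       (weightIn≥0 (end x) b y s≤e))

  volumeIn-split : ∀ a b x ys → Nonneg ys → (∀ i → Disjoint x (lookup ys i)) →
                   volumeIn a b ys ≤ volumeIn a (start x) ys + volumeIn (end x) b ys
  volumeIn-split a b x []       nn dis = ℚₚ.≤-refl
  volumeIn-split a b x (y ∷ ys) nn dis = ℚₚ.≤-trans
    (ℚₚ.+-mono-≤ (weightIn-split a b x y (nn Fin.zero) (dis Fin.zero))
                 (volumeIn-split a b x ys (nn ∘ Fin.suc) (dis ∘ Fin.suc)))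
    (ℚₚ.≤-reflexive (solve 4 (λ a b c d → (a :+ b) :+ (c :+ d) := (a :+ c) :+ (b :+ d)) refl
      (weightIn a (start x) y) (weightIn (end x) b y) (volumeIn a (start x) ys) (volumeIn (end x) b ys)))
    where open +-*-Solver

  -- Induction on the list, for all intervals at once: a first piece inside [a, b] leaves the two
  -- intervals before and after it, and the induction hypothesis is applied to the remaining pieces
  -- in each.
  packing : ∀ xs → Nonneg xs → (∀ i i′ → ¬ (i ≡ i′) → Disjoint (lookup xs i) (lookup xs i′)) →
            ∀ {a b} → a ≤ b → volumeIn a b xs ≤ b - a
  packing []       nn dis {a} {b} a≤b = subst (_≤ b - a) (ℚₚ.+-inverseʳ a) (ℚₚ.+-monoˡ-≤ (- a) a≤b)
  packing (x ∷ xs) nn dis {a} {b} a≤b with inside? a b x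
  ... | no _ = ℚₚ.≤-trans (ℚₚ.≤-reflexive (ℚₚ.+-identityˡ _))
    (packing xs (nn ∘ Fin.suc) (λ i i′ i≢i′ → dis (Fin.suc i) (Fin.suc i′) (i≢i′ ∘ Finₚ.suc-injective)) a≤b)
  ... | yes (a≤s , e≤b) = begin
    len x + volumeIn a b xs                                    ≤⟨ ℚₚ.+-monoʳ-≤ (len x) (volumeIn-split a b x xs (nn ∘ Fin.suc) (λ i → dis Fin.zero (Fin.suc i) λ ())) ⟩
    len x + (volumeIn a (start x) xs + volumeIn (end x) b xs)  ≤⟨ ℚₚ.+-monoʳ-≤ (len x) (ℚₚ.+-mono-≤ (ih a≤s) (ih e≤b)) ⟩
    len x + ((start x - a) + (b - end x))                      ≡⟨ solve 4 (λ s e a b → (e :- s) :+ ((s :- a) :+ (b :- e)) := b :- a) refl (start x) (end x) a b ⟩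
    b - a                                                      ∎
    where
    open ℚₚ.≤-Reasoning hiding (start)
    open +-*-Solver
    ih : ∀ {a b} → a ≤ b → volumeIn a b xs ≤ b - a
    ih = packing xs (nn ∘ Fin.suc) (λ i i′ i≢i′ → dis (Fin.suc i) (Fin.suc i′) (i≢i′ ∘ Finₚ.suc-injective))

  -- By unfolding, these are `processed` and `completion`; taking the list of pieces as an argument
  -- permits induction on it.
  processedBy completionBy : List (Piece n) → Fin n → ℚ
  processedBy xs j = foldr (λ pc acc → if does (job pc Fin.≟ j) then len pc + acc else acc) 0ℚ xs
  completionBy xs j = foldr (λ pc acc → if does (job pc Fin.≟ j) then end pc ⊔ acc else acc) 0ℚ xs

  end≤completion : ∀ xs i → end (lookup xs i) ≤ completionBy xs (job (lookup xs i))
  end≤completion (x ∷ xs) Fin.zero with job x Fin.≟ job x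
  ... | yes _  = ℚₚ.p≤p⊔q (end x) _
  ... | no x≢x = contradiction refl x≢x
  end≤completion (x ∷ xs) (Fin.suc i) with does (job x Fin.≟ job (lookup xs i))
  ... | true  = ℚₚ.≤-trans (end≤completion xs i) (ℚₚ.p≤q⊔p (end x) _)
  ... | false = end≤completion xs i

  -- Each piece adds its length to one job only, so the sum over `K` collects every piece of a job
  -- in `K` once, and all of these lie inside [a, b].
  sumOn-processed-≤-volume : ∀ (K : Fin n → Bool) a b xs → Nonneg xs →
    (∀ i → K (job (lookup xs i)) ≡ true → a ≤ start (lookup xs i) × end (lookup xs i) ≤ b) →
    sumOn K (processedBy xs) ≤ volumeIn a b xs
  sumOn-processed-≤-volume K a b [] nn inside = ℚₚ.≤-reflexive (sumOn-0 K)
  sumOn-processed-≤-volume K a b (x ∷ xs) nn inside = begin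
    sumOn K (processedBy (x ∷ xs))                     ≡⟨ sumℚ-cong n (λ j → lem (K j) (does (job x Fin.≟ j)) (processedBy xs j)) ⟩
    sumℚ n (λ j → xK j + restK j)                      ≡⟨ sumℚ-+ n xK restK ⟩
    sumℚ n xK + sumOn K (processedBy xs)               ≡⟨ cong (_+ _) (sumOn-single K (job x) (len x)) ⟩
    (if K (job x) then len x else 0ℚ) + sumOn K (processedBy xs) ≤⟨ ℚₚ.+-mono-≤ head≤ (sumOn-processed-≤-volume K a b xs (nn ∘ Fin.suc) (inside ∘ Fin.suc)) ⟩
    weightIn a b x + volumeIn a b xs                   ∎
    where
    open ℚₚ.≤-Reasoning hiding (start)
    xK restK : Fin n → ℚ
    xK j = if K j then (if does (job x Fin.≟ j) then len x else 0ℚ) else 0ℚ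
    restK j = if K j then processedBy xs j else 0ℚ
    lem : ∀ k d acc → (if k then (if d then len x + acc else acc) else 0ℚ) ≡
                      (if k then (if d then len x else 0ℚ) else 0ℚ) + (if k then acc else 0ℚ)
    lem true  true  acc = refl
    lem true  false acc = sym (ℚₚ.+-identityˡ acc)
    lem false d     acc = refl
    head≤ : (if K (job x) then len x else 0ℚ) ≤ weightIn a b x
    head≤ with K (job x) in eq
    ... | true  = ℚₚ.≤-reflexive (sym (weightIn-inside x (proj₁ (inside Fin.zero eq)) (proj₂ (inside Fin.zero eq))))
    ... | false = weightIn≥0 a b x (nn Fin.zero)

-- Optimal schedules

module _ {n : ℕ} where

  open Piece

  lookup-tabulate′ : ∀ {m} (g : Fin m → Piece n) i → lookup (tabulate g) i ≡ g (Fin.cast (length-tabulate g) i)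
  lookup-tabulate′ {suc m} g Fin.zero    = refl
  lookup-tabulate′ {suc m} g (Fin.suc i) = lookup-tabulate′ (g ∘ Fin.suc) i

  processed-none : ∀ {m} (g : Fin m → Piece n) j → (∀ i → job (g i) ≢ j) → processedBy (tabulate g) j ≡ 0ℚ
  processed-none {zero}  g j none = refl
  processed-none {suc m} g j none rewrite dec-false (job (g Fin.zero) Fin.≟ j) (none Fin.zero) =
    processed-none (g ∘ Fin.suc) j (none ∘ Fin.suc)

  completion-none : ∀ {m} (g : Fin m → Piece n) j → (∀ i → job (g i) ≢ j) → completionBy (tabulate g) j ≡ 0ℚ
  completion-none {zero}  g j none = refl
  completion-none {suc m} g j none rewrite dec-false (job (g Fin.zero) Fin.≟ j) (none Fin.zero) =
    completion-none (g ∘ Fin.suc) j (none ∘ Fin.suc)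

  -- The optimal schedule is nonpreemptive; with distinct pieces on distinct jobs, the folds over
  -- the pieces reduce to a single term.
  OnePieceEach : ∀ {m} → (Fin m → Piece n) → Set
  OnePieceEach g = ∀ i i′ → job (g i) ≡ job (g i′) → i ≡ i′

  others : ∀ {m} (g : Fin (suc m) → Piece n) → OnePieceEach g → ∀ i → job (g (Fin.suc i)) ≢ job (g Fin.zero)
  others g inj i eq = contradiction (inj (Fin.suc i) Fin.zero eq) λ ()

  tail-inj : ∀ {m} (g : Fin (suc m) → Piece n) → OnePieceEach g → OnePieceEach (g ∘ Fin.suc)
  tail-inj g inj i i′ = Finₚ.suc-injective ∘ inj (Fin.suc i) (Fin.suc i′)

  processed-single : ∀ {m} (g : Fin m → Piece n) → OnePieceEach g → ∀ i →
                     processedBy (tabulate g) (job (g i)) ≡ len (g i)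
  processed-single {suc m} g inj Fin.zero
    rewrite dec-true (job (g Fin.zero) Fin.≟ job (g Fin.zero)) refl
          | processed-none (g ∘ Fin.suc) (job (g Fin.zero)) (others g inj) = ℚₚ.+-identityʳ _
  processed-single {suc m} g inj (Fin.suc i)
    rewrite dec-false (job (g Fin.zero) Fin.≟ job (g (Fin.suc i))) (others g inj i ∘ sym) =
    processed-single (g ∘ Fin.suc) (tail-inj g inj) i

  -- The fold for completion times starts from 0ℚ, so the end of the only piece survives the maximum
  -- because it is nonnegative.
  completion-single : ∀ {m} (g : Fin m → Piece n) → OnePieceEach g → (∀ i → 0ℚ ≤ end (g i)) → ∀ i →
                      completionBy (tabulate g) (job (g i)) ≡ end (g i)
  completion-single {suc m} g inj 0≤end Fin.zero
    rewrite dec-true (job (g Fin.zero) Fin.≟ job (g Fin.zero)) refl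
          | completion-none (g ∘ Fin.suc) (job (g Fin.zero)) (others g inj) = ℚₚ.p≥q⇒p⊔q≡p (0≤end Fin.zero)
  completion-single {suc m} g inj 0≤end (Fin.suc i)
    rewrite dec-false (job (g Fin.zero) Fin.≟ job (g (Fin.suc i))) (others g inj i ∘ sym) =
    completion-single (g ∘ Fin.suc) (tail-inj g inj) (0≤end ∘ Fin.suc) i

-- Jobs are indexed by increasing size F, and no job can be completed before E. Any c + 1 jobs need
-- at least earliest c = E + F 0 + … + F (c - 1) to be completed, because the one released first, at R,
-- satisfies R + F ≥ E and the c others are at least as long as the c shortest jobs.
module Prefix
  (w d : ℕ) (F R : ℕ → ℕ) (E : ℕ)
  (F-pos : ∀ j → 1 ℕ.≤ F j)
  (F-mono : ∀ {i j} → i ℕ.≤ j → F i ℕ.≤ F j)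
  where

  -- `w` is the index of the last of the first Π jobs, and `d` is the number of jobs beyond them.
  n Π : ℕ
  Π = suc w
  n = Π ℕ.+ d

  I : Instance
  I = record { n = n ; r = R ∘ toℕ ; p = F ∘ toℕ ; p-pos = F-pos ∘ toℕ ; Π = Π ; Π-pos = ℕ.s≤s ℕ.z≤n }

  before : ℕ → ℕ
  before j = sumℕ j (F ∘ toℕ)

  earliest : ℕ → ℕ
  earliest c = E ℕ.+ before c

  module _ (σ : Solution I) (valid : Valid σ) (E≤R+F : ∀ j → j ℕ.< n → E ℕ.≤ R j ℕ.+ F j) where
    open Solution σ
    open Valid valid
    open Piece

    nonneg : Nonneg pieces
    nonneg i = ℚₚ.<⇒≤ (proj₁ (piece-ok i))

    completion-bound : ∀ K → (∀ j → K j ≡ true → S j ≡ true) → ∀ c → count K ≡ suc c →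
                       ∀ τ → (∀ j → K j ≡ true → completion σ j ≤ τ) → ℕtoℚ (earliest c) ≤ τ
    completion-bound K K⊆S c |K|≡ τ done
      -- With the order reversed, the maximum is a job `m` of least release date in `K`.
      with max-on (flip ℕₚ.≤-total) (flip ℕₚ.≤-trans) K (R ∘ toℕ) |K|≡
    ... | m , m∈ , first = [ (λ b≡τ → subst (ℕtoℚ (earliest c) ≤_) b≡τ early)
                           -- Here the window has length zero but would contain a positive amount of
                           -- work.
                           , (λ b≡a → contradiction (ℚₚ.<-≤-trans (ℕtoℚ-mono-< R<R+work) (overfull b≡a)) (ℚₚ.<-irrefl refl))
                           ]′ (ℚₚ.⊔-sel τ a)
      where
      -- b is τ; the maximum is there because the packing bound needs a ≤ b.
      a b : ℚ
      a = ℕtoℚ (R (toℕ m))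
      b = τ ⊔ a

      work rest : ℕ
      work = sumOnℕ K (F ∘ toℕ)
      rest = sumOnℕ (K ∖ m) (F ∘ toℕ)

      work≡ : work ≡ F (toℕ m) ℕ.+ rest
      work≡ = sumOnℕ-remove K (F ∘ toℕ) m m∈

      rest≥ : before c ℕ.≤ rest
      rest≥ = subst (λ x → before x ℕ.≤ rest) (ℕₚ.suc-injective (trans (sym (sumOnℕ-remove K (λ _ → 1) m m∈)) |K|≡))
                (prefix-≤-sumOnℕ (K ∖ m) F F-mono)

      R<R+work : R (toℕ m) ℕ.< R (toℕ m) ℕ.+ work
      R<R+work = ℕₚ.m<m+n (R (toℕ m)) (subst (0 ℕ.<_) (sym work≡) (ℕₚ.<-≤-trans (F-pos (toℕ m)) (ℕₚ.m≤m+n _ rest)))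

      -- Every piece of a job in `K` starts no earlier than the least release date a and ends by τ,
      -- hence by b, so the packing bound applies to the whole work of `K`.
      fits : a + ℕtoℚ work ≤ b
      fits = p≤q-r⇒r+p≤q (begin
        ℕtoℚ work                                 ≡⟨ sumOn-ℕtoℚ K (F ∘ toℕ) ⟨
        sumOn K (ℕtoℚ ∘ F ∘ toℕ)                  ≡⟨ sumOn-cong K (λ j j∈ → full j (K⊆S j j∈)) ⟨
        sumOn K (processedBy pieces)              ≤⟨ sumOn-processed-≤-volume K a b pieces nonneg (λ i i∈ →
                                                       ℚₚ.≤-trans (ℕtoℚ-mono-≤ (first _ i∈)) (proj₁ (proj₂ (piece-ok i))) ,
                                                       ℚₚ.≤-trans (end≤completion pieces i) (ℚₚ.≤-trans (done _ i∈) (ℚₚ.p≤p⊔q τ a))) ⟩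
        volumeIn a b pieces                       ≤⟨ packing pieces nonneg disjoint (ℚₚ.p≤q⊔p τ a) ⟩
        b - a                                     ∎)
        where open ℚₚ.≤-Reasoning

      fitsℕ : ℕtoℚ (R (toℕ m) ℕ.+ work) ≤ b
      fitsℕ = subst (_≤ b) (sym (ℕtoℚ-homo-+ (R (toℕ m)) work)) fits

      early : ℕtoℚ (earliest c) ≤ b
      early = ℚₚ.≤-trans (ℕtoℚ-mono-≤ (begin
        E ℕ.+ before c                            ≤⟨ ℕₚ.+-mono-≤ (E≤R+F (toℕ m) (Finₚ.toℕ<n m)) rest≥ ⟩
        R (toℕ m) ℕ.+ F (toℕ m) ℕ.+ rest          ≡⟨ ℕₚ.+-assoc (R (toℕ m)) _ rest ⟩
        R (toℕ m) ℕ.+ (F (toℕ m) ℕ.+ rest)        ≡⟨ cong (R (toℕ m) ℕ.+_) work≡ ⟨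
        R (toℕ m) ℕ.+ work                        ∎)) fitsℕ
        where open ℕₚ.≤-Reasoning

      overfull : b ≡ a → ℕtoℚ (R (toℕ m) ℕ.+ work) ≤ a
      overfull b≡a = subst (ℕtoℚ (R (toℕ m) ℕ.+ work) ≤_) b≡a fitsℕ

  optimum : ℚ
  optimum = ℕtoℚ (sumℕ Π (earliest ∘ toℕ)) - ℕtoℚ (sumℕ Π (R ∘ toℕ))

  -- θ separates the release dates of the first Π jobs from the others. Selecting Π + e jobs raises
  -- the total release date by at most e θ over that of the prefix, while the e additional
  -- completion bounds are each at least E, hence at least θ. So extra jobs never lower the cost.
  cost-lower-bound : (∀ j → j ℕ.< n → E ℕ.≤ R j ℕ.+ F j) →
    ∀ θ → θ ℕ.≤ E → (∀ j → j ℕ.< Π → θ ℕ.≤ R j) → (∀ j → Π ℕ.≤ j → R j ℕ.≤ θ) →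
    ∀ (σ : Solution I) → Valid σ → optimum ≤ cost σ
  cost-lower-bound E≤R+F θ θ≤E hi lo σ valid with ℕₚ.m≤n⇒∃[o]m+o≡n (Valid.enough valid)
  ... | e , Π+e≡card = begin
    optimum                                             ≤⟨ p+s≤r+q⇒p-q≤r-s (ℕtoℚ QΠ) (ℕtoℚ RΠ) (ℕtoℚ Qm) (ℕtoℚ RS)
                                                             (subst₂ _≤_ (ℕtoℚ-homo-+ QΠ RS) (ℕtoℚ-homo-+ Qm RΠ) (ℕtoℚ-mono-≤ releases)) ⟩
    ℕtoℚ Qm - ℕtoℚ RS                                   ≤⟨ ℚₚ.+-monoˡ-≤ (- ℕtoℚ RS) (sum-of-order-statistics (completion σ) earliest S
                                                             (completion-bound σ valid E≤R+F) (Π ℕ.+ e) (sym Π+e≡card)) ⟩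
    sumOn S (completion σ) - ℕtoℚ RS                    ≡⟨ cong (λ x → sumOn S (completion σ) - x) (sumOn-ℕtoℚ S (R ∘ toℕ)) ⟨
    sumOn S (completion σ) - sumOn S (ℕtoℚ ∘ R ∘ toℕ)   ≡⟨ sumOn-- S (completion σ) (ℕtoℚ ∘ R ∘ toℕ) ⟨
    cost σ                                              ∎
    where
    open ℚₚ.≤-Reasoning
    open Solution σ
    QΠ Qm RS RΠ : ℕ
    QΠ = sumℕ Π (earliest ∘ toℕ)
    Qm = sumℕ (Π ℕ.+ e) (earliest ∘ toℕ)
    RS = sumOnℕ S (R ∘ toℕ)
    RΠ = sumℕ Π (R ∘ toℕ)

    RS≤ : RS ℕ.≤ RΠ ℕ.+ e ℕ.* θ
    RS≤ = ℕₚ.+-cancelʳ-≤ (Π ℕ.* θ) RS (RΠ ℕ.+ e ℕ.* θ) (subst (RS ℕ.+ Π ℕ.* θ ℕ.≤_)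
      (trans (cong (λ x → RΠ ℕ.+ x ℕ.* θ) (sym Π+e≡card))
        (solve 4 (λ a b e t → a :+ (b :+ e) :* t := a :+ e :* t :+ b :* t) refl RΠ Π e θ))
      (sumOnℕ-≤-prefix S R Π θ hi lo))
      where open ℕ-Solver

    Qm≥ : QΠ ℕ.+ e ℕ.* θ ℕ.≤ Qm
    Qm≥ = subst₂ (λ x y → QΠ ℕ.+ x ℕ.≤ y) (sumℕ-const e θ) (sym (sumℕ-++ Π e earliest))
      (ℕₚ.+-monoʳ-≤ QΠ (sumℕ-mono-≤ e (λ i → ℕₚ.≤-trans θ≤E (ℕₚ.m≤m+n E _))))

    releases : QΠ ℕ.+ RS ℕ.≤ Qm ℕ.+ RΠ
    releases = ℕₚ.≤-trans (ℕₚ.+-monoʳ-≤ QΠ RS≤) (ℕₚ.≤-trans (ℕₚ.≤-reflexive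
      (solve 3 (λ a b c → a :+ (b :+ c) := (a :+ c) :+ b) refl QΠ RΠ (e ℕ.* θ))) (ℕₚ.+-monoˡ-≤ RΠ Qm≥))
      where open ℕ-Solver

  -- The last selected job exactly fills the time from its release to E; the others follow from E on by index.
  startTime endTime : ℕ → ℕ
  startTime j = if does (j ℕ.≟ w) then R w else earliest j
  endTime j = startTime j ℕ.+ F j

  selected : Fin Π → Piece n
  selected i = piece (i ↑ˡ d) (ℕtoℚ (startTime (toℕ i))) (ℕtoℚ (endTime (toℕ i)))

  schedule : Solution I
  schedule = record { S = λ j → toℕ j ℕ.<ᵇ Π ; pieces = tabulate selected }

  module _ (R≤earliest : ∀ j → R j ℕ.≤ earliest j) (tight : R w ℕ.+ F w ≡ E) where

    startTime-last : startTime w ≡ R w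
    startTime-last = cong (if_then R w else earliest w) (dec-true (w ℕ.≟ w) refl)

    startTime-≢ : ∀ {j} → j ≢ w → startTime j ≡ earliest j
    startTime-≢ {j} j≢w = cong (if_then R w else earliest j) (dec-false (j ℕ.≟ w) j≢w)

    endTime-last : endTime w ≡ E
    endTime-last = trans (cong (ℕ._+ F w) startTime-last) tight

    endTime-≢ : ∀ {j} → j ≢ w → endTime j ≡ earliest (suc j)
    endTime-≢ {j} j≢w = trans (cong (ℕ._+ F j) (startTime-≢ j≢w))
      (trans (ℕₚ.+-assoc E (before j) (F j)) (cong (E ℕ.+_) (sym (sumℕ-snoc j F))))

    released : ∀ j → R j ℕ.≤ startTime j
    released j with j ℕ.≟ w
    ... | yes refl = ℕₚ.≤-reflexive (sym startTime-last)
    ... | no j≢w   = subst (R j ℕ.≤_) (sym (startTime-≢ j≢w)) (R≤earliest j)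

    endTime≤ : ∀ j → j ℕ.< Π → endTime j ℕ.≤ earliest w
    endTime≤ j j<Π with j ℕ.≟ w
    ... | yes refl = subst (ℕ._≤ earliest w) (sym endTime-last) (ℕₚ.m≤m+n E _)
    ... | no j≢w   = subst (ℕ._≤ earliest w) (sym (endTime-≢ j≢w))
                       (ℕₚ.+-monoʳ-≤ E (sumℕ-prefix-mono F (ℕₚ.≤∧≢⇒< (ℕ.s≤s⁻¹ j<Π) j≢w)))

    disjointTimes : ∀ {i j} → i ℕ.< j → j ℕ.< Π → endTime i ℕ.≤ startTime j ⊎ endTime j ℕ.≤ startTime i
    disjointTimes {i} {j} i<j j<Π with j ℕ.≟ w
    -- Job `w` has the largest selected index but runs first: it ends at E, where the others begin.
    ... | yes refl = inj₂ (subst₂ ℕ._≤_ (sym endTime-last) (sym (startTime-≢ (ℕₚ.<⇒≢ i<j))) (ℕₚ.m≤m+n E _))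
    ... | no j≢w   = inj₁ (subst₂ ℕ._≤_ (sym (endTime-≢ (ℕₚ.<⇒≢ (ℕₚ.<-≤-trans i<j (ℕ.s≤s⁻¹ j<Π))))) (sym (startTime-≢ j≢w))
                       (ℕₚ.+-monoʳ-≤ E (sumℕ-prefix-mono F i<j)))

    position : Fin (length (tabulate selected)) → Fin Π
    position = Fin.cast (length-tabulate selected)

    selected-disjoint : ∀ i i′ → i ≢ i′ → Disjoint (selected i) (selected i′)
    selected-disjoint i i′ i≢i′ with ℕₚ.<-cmp (toℕ i) (toℕ i′)
    ... | tri< i<i′ _ _ = [ inj₁ ∘ ℕtoℚ-mono-≤ , inj₂ ∘ ℕtoℚ-mono-≤ ]′ (disjointTimes i<i′ (Finₚ.toℕ<n i′))
    ... | tri≈ _ i≡i′ _ = contradiction (Finₚ.toℕ-injective i≡i′) i≢i′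
    ... | tri> _ _ i′<i = [ inj₂ ∘ ℕtoℚ-mono-≤ , inj₁ ∘ ℕtoℚ-mono-≤ ]′ (disjointTimes i′<i (Finₚ.toℕ<n i))

    one-piece-each : OnePieceEach selected
    one-piece-each i i′ = Finₚ.↑ˡ-injective d i i′

    S-selected : ∀ i → Solution.S schedule (i ↑ˡ d) ≡ true
    S-selected i = Equivalence.to T-≡ (ℕₚ.<⇒<ᵇ (subst (ℕ._< Π) (sym (Finₚ.toℕ-↑ˡ i d)) (Finₚ.toℕ<n i)))

    selected-of : ∀ j → Solution.S schedule j ≡ true → ∃[ i ] i ↑ˡ d ≡ j × toℕ i ≡ toℕ j
    selected-of j j∈ = Fin.fromℕ< j<Π , Finₚ.toℕ-injective (trans (Finₚ.toℕ-↑ˡ _ d) eq) , eq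
      where
      j<Π : toℕ j ℕ.< Π
      j<Π = ℕₚ.<ᵇ⇒< (toℕ j) Π (Equivalence.from T-≡ j∈)
      eq = Finₚ.toℕ-fromℕ< j<Π

    len-selected : ∀ i → len (selected i) ≡ ℕtoℚ (F (toℕ i))
    len-selected i = trans (cong (_- ℕtoℚ s) (ℕtoℚ-homo-+ s (F (toℕ i))))
      (solve 2 (λ s f → s :+ f :- s := f) refl (ℕtoℚ s) (ℕtoℚ (F (toℕ i))))
      where
      open +-*-Solver
      s = startTime (toℕ i)

    schedule-card : card schedule ≡ Π
    schedule-card = trans (sumOnℕ-prefix Π d (λ _ → 1)) (trans (sumℕ-const Π 1) (ℕₚ.*-identityʳ Π))

    schedule-valid : Valid schedule
    schedule-valid = record
      { piece-ok = λ i → subst PieceOk (sym (lookup-tabulate′ selected i)) (selected-ok (position i))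
      ; disjoint = λ i i′ i≢i′ → subst₂ Disjoint (sym (lookup-tabulate′ selected i)) (sym (lookup-tabulate′ selected i′))
          (selected-disjoint (position i) (position i′) (i≢i′ ∘ λ eq → Finₚ.toℕ-injective
            (trans (sym (Finₚ.toℕ-cast (length-tabulate selected) i)) (trans (cong toℕ eq) (Finₚ.toℕ-cast (length-tabulate selected) i′)))))
      ; full = λ j j∈ → full′ j (selected-of j j∈)
      ; enough = ℕₚ.≤-reflexive (sym schedule-card)
      }
      where
      PieceOk : Piece n → Set
      PieceOk pc = (Piece.start pc < Piece.end pc) × (ℕtoℚ (R (toℕ (Piece.job pc))) ≤ Piece.start pc)
                   × (Solution.S schedule (Piece.job pc) ≡ true)
      selected-ok : ∀ i → PieceOk (selected i)
      selected-ok i = ℕtoℚ-mono-< (ℕₚ.m<m+n (startTime (toℕ i)) (F-pos (toℕ i)))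
                    , ℕtoℚ-mono-≤ (subst (λ k → R k ℕ.≤ startTime (toℕ i)) (sym (Finₚ.toℕ-↑ˡ i d)) (released (toℕ i)))
                    , S-selected i
      full′ : ∀ j → ∃[ i ] i ↑ˡ d ≡ j × toℕ i ≡ toℕ j → processed schedule j ≡ ℕtoℚ (F (toℕ j))
      full′ j (i , refl , i≡j) = trans (processed-single selected one-piece-each i) (trans (len-selected i) (cong (ℕtoℚ ∘ F) i≡j))

    schedule-completes : CompletesBy schedule (earliest w)
    schedule-completes i = subst (λ pc → Piece.end pc ≤ ℕtoℚ (earliest w)) (sym (lookup-tabulate′ selected i))
      (ℕtoℚ-mono-≤ (endTime≤ (toℕ (position i)) (Finₚ.toℕ<n (position i))))

    schedule-completion : ∀ j → Solution.S schedule j ≡ true → completion schedule j ≡ ℕtoℚ (endTime (toℕ j))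
    schedule-completion j j∈ with selected-of j j∈
    ... | i , refl , i≡j = trans (completion-single selected one-piece-each (λ i → 0≤ℕtoℚ (endTime (toℕ i))) i) (cong (ℕtoℚ ∘ endTime) i≡j)

    -- The end times are the bounds in cyclic order: job j below w ends at `earliest (suc j)`, and
    -- job w ends at E, which is `earliest 0`.
    sum-endTimes : sumℕ Π (endTime ∘ toℕ) ≡ sumℕ Π (earliest ∘ toℕ)
    sum-endTimes = begin
      sumℕ (suc w) (endTime ∘ toℕ)              ≡⟨ sumℕ-snoc w endTime ⟩
      sumℕ w (endTime ∘ toℕ) ℕ.+ endTime w      ≡⟨ cong₂ ℕ._+_ (sumℕ-cong w (λ i → endTime-≢ (ℕₚ.<⇒≢ (Finₚ.toℕ<n i)))) (trans endTime-last (sym (ℕₚ.+-identityʳ E))) ⟩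
      sumℕ w (earliest ∘ suc ∘ toℕ) ℕ.+ earliest 0  ≡⟨ ℕₚ.+-comm _ (earliest 0) ⟩
      sumℕ (suc w) (earliest ∘ toℕ)             ∎
      where open ≡-Reasoning

    schedule-cost : cost schedule ≡ optimum
    schedule-cost = begin
      cost schedule                                                    ≡⟨ sumOn-- S (completion schedule) (ℕtoℚ ∘ R ∘ toℕ) ⟩
      sumOn S (completion schedule) - sumOn S (ℕtoℚ ∘ R ∘ toℕ)         ≡⟨ cong (_- sumOn S (ℕtoℚ ∘ R ∘ toℕ)) (sumOn-cong S schedule-completion) ⟩
      sumOn S (ℕtoℚ ∘ endTime ∘ toℕ) - sumOn S (ℕtoℚ ∘ R ∘ toℕ)        ≡⟨ cong₂ _-_ (sumOn-ℕtoℚ S (endTime ∘ toℕ)) (sumOn-ℕtoℚ S (R ∘ toℕ)) ⟩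
      ℕtoℚ (sumOnℕ S (endTime ∘ toℕ)) - ℕtoℚ (sumOnℕ S (R ∘ toℕ))      ≡⟨ cong₂ (λ x y → ℕtoℚ x - ℕtoℚ y) (trans (sumOnℕ-prefix Π d endTime) sum-endTimes) (sumOnℕ-prefix Π d R) ⟩
      optimum                                                          ∎
      where
      open ≡-Reasoning
      open Solution schedule using (S)

-- The instance and its fractional solution

invPow2-inverse : ∀ k → invPow2 k * ℕtoℚ (2 ℕ.^ k) ≡ 1ℚ
invPow2-inverse zero    = refl
invPow2-inverse (suc k) = begin
  ½ * invPow2 k * ℕtoℚ (2 ℕ.* 2 ℕ.^ k)             ≡⟨ cong (½ * invPow2 k *_) (ℕtoℚ-homo-* 2 (2 ℕ.^ k)) ⟩
  ½ * invPow2 k * (ℕtoℚ 2 * ℕtoℚ (2 ℕ.^ k))        ≡⟨ solve 2 (λ a b → con ½ :* a :* (con (ℕtoℚ 2) :* b) := a :* b) refl (invPow2 k) (ℕtoℚ (2 ℕ.^ k)) ⟩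
  invPow2 k * ℕtoℚ (2 ℕ.^ k)                       ≡⟨ invPow2-inverse k ⟩
  1ℚ                                               ∎
  where open ≡-Reasoning
        open +-*-Solver

invPow2-nonNeg : ∀ k → NonNegative (invPow2 k)
invPow2-nonNeg zero    = _
invPow2-nonNeg (suc k) = ℚₚ.nonNeg*nonNeg⇒nonNeg ½ (invPow2 k) {{invPow2-nonNeg k}}

inv-p̃-2^ : ∀ k → inv-p̃ (2 ℕ.^ k) ≡ invPow2 k
inv-p̃-2^ k = cong invPow2 (⌈log₂2^n⌉≡n k)

sum-powers-≤ : ∀ n → sumℕ n (λ i → 2 ℕ.^ suc (toℕ i)) ℕ.≤ 2 ℕ.^ suc n
sum-powers-≤ zero    = ℕ.z≤n
sum-powers-≤ (suc n) = begin
  sumℕ (suc n) (λ i → 2 ℕ.^ suc (toℕ i))                ≡⟨ sumℕ-snoc n (λ i → 2 ℕ.^ suc i) ⟩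
  sumℕ n (λ i → 2 ℕ.^ suc (toℕ i)) ℕ.+ 2 ℕ.^ suc n      ≤⟨ ℕₚ.+-monoˡ-≤ (2 ℕ.^ suc n) (sum-powers-≤ n) ⟩
  2 ℕ.^ suc n ℕ.+ 2 ℕ.^ suc n                           ≡⟨ cong (2 ℕ.^ suc n ℕ.+_) (ℕₚ.+-identityʳ _) ⟨
  2 ℕ.^ suc (suc n)                                     ∎
  where open ℕₚ.≤-Reasoning

indicator : Bool → ℚ
indicator b = if b then 1ℚ else 0ℚ

0≤indicator : ∀ b → 0ℚ ≤ indicator b
0≤indicator true  = *≤* (ℤ.+≤+ ℕ.z≤n)
0≤indicator false = ℚₚ.≤-refl

sumℚ-exclusive : ∀ n (b : Fin n → Bool) → (∀ i j → b i ≡ true → b j ≡ true → i ≡ j) →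
                 sumℚ n (indicator ∘ b) ≤ 1ℚ
sumℚ-exclusive zero    b excl = 0≤indicator true
sumℚ-exclusive (suc n) b excl with b Fin.zero in eq
... | false = ℚₚ.≤-trans (ℚₚ.≤-reflexive (ℚₚ.+-identityˡ _))
                (sumℚ-exclusive n (b ∘ Fin.suc) (λ i j p q → Finₚ.suc-injective (excl _ _ p q)))
... | true  = ℚₚ.≤-reflexive (cong (1ℚ +_) (trans (sumℚ-cong n (λ i → rest (b (Fin.suc i)) (λ p → contradiction (excl _ _ eq p) λ ()))) (sumℚ-0 n)))
  where
  rest : ∀ c → c ≢ true → indicator c ≡ 0ℚ
  rest true  c≢ = contradiction refl c≢
  rest false c≢ = refl

-- Abstract, so that the decision stays unreduced and the case split on it in `term≤` also rewrites
-- `window`.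
abstract
  inWindow? : ∀ a l t → Dec (a ℕ.≤ t × t ℕ.< a ℕ.+ l)
  inWindow? a l t = (a ℕ.≤? t) ×-dec (t ℕ.<? a ℕ.+ l)

window : ℕ → ℕ → ℕ → ℚ
window a l t = indicator (does (inWindow? a l t))

window-in : ∀ {a l t} → a ℕ.≤ t → t ℕ.< a ℕ.+ l → window a l t ≡ 1ℚ
window-in {a} {l} {t} a≤t t<a+l = cong indicator (dec-true (inWindow? a l t) (a≤t , t<a+l))

window-out : ∀ {a l t} → ¬ (a ℕ.≤ t × t ℕ.< a ℕ.+ l) → window a l t ≡ 0ℚ
window-out {a} {l} {t} out = cong indicator (dec-false (inWindow? a l t) out)

does⇒ : ∀ {A : Set} (a? : Dec A) → does a? ≡ true → A
does⇒ (yes a) _ = a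

-- The slots are cut at a and at a + l; only the middle block contributes, with 1 per slot.
window-sum : ∀ a l {N} → a ℕ.+ l ℕ.≤ N → sumℚ N (window a l ∘ toℕ) ≡ ℕtoℚ l
window-sum a l a+l≤N with ℕₚ.m≤n⇒∃[o]m+o≡n a+l≤N
... | o , refl = begin
  sumℚ (a ℕ.+ l ℕ.+ o) (window a l ∘ toℕ)                                                        ≡⟨ sumℚ-++ (a ℕ.+ l) o (window a l) ⟩
  sumℚ (a ℕ.+ l) (window a l ∘ toℕ) + sumℚ o (λ i → window a l (a ℕ.+ l ℕ.+ toℕ i))              ≡⟨ cong₂ _+_ (sumℚ-++ a l (window a l))
                                                                                                      (trans (sumℚ-cong o (λ i → window-out λ (_ , lt) → ℕₚ.m+n≮m _ _ lt)) (sumℚ-0 o)) ⟩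
  sumℚ a (window a l ∘ toℕ) + sumℚ l (λ i → window a l (a ℕ.+ toℕ i)) + 0ℚ                        ≡⟨ ℚₚ.+-identityʳ _ ⟩
  sumℚ a (window a l ∘ toℕ) + sumℚ l (λ i → window a l (a ℕ.+ toℕ i))                             ≡⟨ cong₂ _+_
      (trans (sumℚ-cong a (λ i → window-out λ (le , _) → ℕₚ.<⇒≱ (Finₚ.toℕ<n i) le)) (sumℚ-0 a))
      (trans (sumℚ-cong l (λ i → window-in (ℕₚ.m≤m+n a _) (ℕₚ.+-monoʳ-< a (Finₚ.toℕ<n i)))) (sumℚ-const l 1ℚ)) ⟩
  0ℚ + ℕtoℚ l * 1ℚ                                                                               ≡⟨ trans (ℚₚ.+-identityˡ _) (ℚₚ.*-identityʳ _) ⟩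
  ℕtoℚ l                                                                                         ∎
  where open ≡-Reasoning

-- Jobs j < E are the unit jobs, and j = E + i is the long job of size 2^(i+1). In the fractional solution
-- job j runs at full rate during the h j slots from its release on, where h = p for units and h = p / 2 for long jobs.
module Gap (N E : ℕ) (E≡ : E ≡ 2 ℕ.^ (suc N ℕ.+ suc N)) where

  -- There are 2D long jobs, and `w` is the index of the D-th shortest of them. Taking D = N + 1
  -- ensures at least one selected long job even for N = 0.
  D w : ℕ
  D = suc N
  w = E ℕ.+ N

  -- Truncated subtraction gives exponent 0 for every unit job, so one formula for sizes serves both
  -- kinds of job.
  F R h : ℕ → ℕ
  F j = 2 ℕ.^ (suc j ℕ.∸ E)
  R j = if j ℕ.<ᵇ E then E ℕ.+ j else E ℕ.∸ F j
  h j = 2 ℕ.^ (j ℕ.∸ E)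

  1≤E : 1 ℕ.≤ E
  1≤E = subst (1 ℕ.≤_) (sym E≡) (ℕₚ.m^n>0 2 (D ℕ.+ D))

  F-pos : ∀ j → 1 ℕ.≤ F j
  F-pos j = ℕₚ.m^n>0 2 (suc j ℕ.∸ E)

  F-mono : ∀ {i j} → i ℕ.≤ j → F i ℕ.≤ F j
  F-mono i≤j = ℕₚ.^-monoʳ-≤ 2 (ℕₚ.∸-monoˡ-≤ E (ℕ.s≤s i≤j))

  F-short : ∀ {j} → j ℕ.< E → F j ≡ 1
  F-short j<E = cong (2 ℕ.^_) (ℕₚ.m≤n⇒m∸n≡0 j<E)

  h-short : ∀ {j} → j ℕ.< E → h j ≡ 1
  h-short j<E = cong (2 ℕ.^_) (ℕₚ.m≤n⇒m∸n≡0 (ℕₚ.<⇒≤ j<E))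

  F-long : ∀ {j} → E ℕ.≤ j → F j ≡ 2 ℕ.* h j
  F-long E≤j = cong (2 ℕ.^_) (ℕₚ.+-∸-assoc 1 E≤j)

  F-shift : ∀ i → F (E ℕ.+ i) ≡ 2 ℕ.^ suc i
  F-shift i = cong (2 ℕ.^_) (trans (cong (ℕ._∸ E) (sym (ℕₚ.+-suc E i))) (ℕₚ.m+n∸m≡n E (suc i)))

  R-short : ∀ {j} → j ℕ.< E → R j ≡ E ℕ.+ j
  R-short {j} j<E = cong (if_then E ℕ.+ j else E ℕ.∸ F j) (Equivalence.to T-≡ (ℕₚ.<⇒<ᵇ j<E))

  R-long : ∀ {j} → E ℕ.≤ j → R j ≡ E ℕ.∸ F j
  R-long {j} E≤j = cong (if_then E ℕ.+ j else E ℕ.∸ F j) (dec-false (j ℕ.<? E) (ℕₚ.≤⇒≯ E≤j))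

  open Prefix w D F R E F-pos F-mono public

  n≡ : n ≡ E ℕ.+ (D ℕ.+ D)
  n≡ = solve 2 (λ e m → con 1 :+ (e :+ m) :+ (con 1 :+ m) := e :+ ((con 1 :+ m) :+ (con 1 :+ m))) refl E N
    where open ℕ-Solver

  Π≡ : Π ≡ E ℕ.+ D
  Π≡ = sym (ℕₚ.+-suc E N)

  F≤E : ∀ {j} → j ℕ.< n → F j ℕ.≤ E
  F≤E {j} j<n = subst (F j ℕ.≤_) (sym E≡) (ℕₚ.^-monoʳ-≤ 2 (begin
    suc j ℕ.∸ E                 ≤⟨ ℕₚ.∸-monoˡ-≤ E j<n ⟩
    n ℕ.∸ E                     ≡⟨ cong (ℕ._∸ E) n≡ ⟩
    E ℕ.+ (D ℕ.+ D) ℕ.∸ E       ≡⟨ ℕₚ.m+n∸m≡n E (D ℕ.+ D) ⟩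
    D ℕ.+ D                     ∎))
    where open ℕₚ.≤-Reasoning

  R+F-long : ∀ {j} → E ℕ.≤ j → j ℕ.< n → R j ℕ.+ F j ≡ E
  R+F-long {j} E≤j j<n = trans (cong (ℕ._+ F j) (R-long E≤j)) (ℕₚ.m∸n+n≡m (F≤E j<n))

  E≤R+F : ∀ j → j ℕ.< n → E ℕ.≤ R j ℕ.+ F j
  E≤R+F j j<n with ℕₚ.<-≤-connex j E
  ... | inj₁ j<E = subst (λ r → E ℕ.≤ r ℕ.+ F j) (sym (R-short j<E)) (ℕₚ.≤-trans (ℕₚ.m≤m+n E j) (ℕₚ.m≤m+n _ (F j)))
  ... | inj₂ E≤j = ℕₚ.≤-reflexive (sym (R+F-long E≤j j<n))

  w<n : w ℕ.< n
  w<n = ℕₚ.m≤m+n (suc w) D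

  E≤w : E ℕ.≤ w
  E≤w = ℕₚ.m≤m+n E N

  tight : R w ℕ.+ F w ≡ E
  tight = R+F-long E≤w w<n

  R-long≤E : ∀ {j} → E ℕ.≤ j → R j ℕ.≤ E
  R-long≤E {j} E≤j = subst (ℕ._≤ E) (sym (R-long E≤j)) (ℕₚ.m∸n≤m E (F j))

  Rw≤R : ∀ j → j ℕ.< Π → R w ℕ.≤ R j
  Rw≤R j j<Π with ℕₚ.<-≤-connex j E
  ... | inj₁ j<E = ℕₚ.≤-trans (R-long≤E E≤w) (subst (E ℕ.≤_) (sym (R-short j<E)) (ℕₚ.m≤m+n E j))
  ... | inj₂ E≤j = subst₂ ℕ._≤_ (sym (R-long E≤w)) (sym (R-long E≤j)) (ℕₚ.∸-monoʳ-≤ E (F-mono (ℕ.s≤s⁻¹ j<Π)))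

  R≤Rw : ∀ j → Π ℕ.≤ j → R j ℕ.≤ R w
  R≤Rw j Π≤j = subst₂ ℕ._≤_ (sym (R-long (ℕₚ.≤-trans E≤w w≤j))) (sym (R-long E≤w)) (ℕₚ.∸-monoʳ-≤ E (F-mono w≤j))
    where
    w≤j : w ℕ.≤ j
    w≤j = ℕₚ.<⇒≤ Π≤j

  j≤before : ∀ j → j ℕ.≤ before j
  j≤before j = subst (ℕ._≤ before j) (trans (sumℕ-const j 1) (ℕₚ.*-identityʳ j)) (sumℕ-mono-≤ j (F-pos ∘ toℕ))

  R≤earliest : ∀ j → R j ℕ.≤ earliest j
  R≤earliest j with ℕₚ.<-≤-connex j E
  ... | inj₁ j<E = subst (ℕ._≤ earliest j) (sym (R-short j<E)) (ℕₚ.+-monoʳ-≤ E (j≤before j))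
  ... | inj₂ E≤j = ℕₚ.≤-trans (R-long≤E E≤j) (ℕₚ.m≤m+n E _)

  schedule-optimal : Optimal schedule
  schedule-optimal = schedule-valid R≤earliest tight , λ σ valid → subst (_≤ cost σ) (sym (schedule-cost R≤earliest tight))
    -- The threshold is the release date of the longest selected job: unit jobs come after E, and
    -- longer jobs are released earlier.
    (cost-lower-bound E≤R+F (R w) (R-long≤E E≤w) Rw≤R R≤Rw σ valid)

  -- The c-th completion time is compared with the release date of job c, which is not the job completed c-th.
  optimum≥ : ℕtoℚ (D ℕ.* E) ≤ optimum
  optimum≥ = subst (_≤ optimum) (solve 2 (λ a b → a :+ b :- a := b) refl (ℕtoℚ RΠ) (ℕtoℚ (D ℕ.* E)))
    (ℚₚ.+-monoˡ-≤ (- ℕtoℚ RΠ) (subst (_≤ ℕtoℚ QΠ) (ℕtoℚ-homo-+ RΠ (D ℕ.* E)) (ℕtoℚ-mono-≤ {RΠ ℕ.+ D ℕ.* E} {QΠ} gap)))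
    where
    open +-*-Solver
    RΠ QΠ : ℕ
    RΠ = sumℕ Π (R ∘ toℕ)
    QΠ = sumℕ Π (earliest ∘ toℕ)
    -- The E + i jobs of smaller index have size at least 1 each, so the bound at this index is at
    -- least 2E, against a release date of at most E.
    long-gap : ∀ i → R (E ℕ.+ i) ℕ.+ E ℕ.≤ earliest (E ℕ.+ i)
    long-gap i = ℕₚ.+-mono-≤ (R-long≤E (ℕₚ.m≤m+n E i)) (ℕₚ.≤-trans (ℕₚ.m≤m+n E i) (j≤before (E ℕ.+ i)))
    gap : RΠ ℕ.+ D ℕ.* E ℕ.≤ QΠ
    gap = begin
      RΠ ℕ.+ D ℕ.* E                                                                    ≡⟨ cong (λ k → sumℕ k (R ∘ toℕ) ℕ.+ D ℕ.* E) Π≡ ⟩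
      sumℕ (E ℕ.+ D) (R ∘ toℕ) ℕ.+ D ℕ.* E                                              ≡⟨ cong (ℕ._+ D ℕ.* E) (sumℕ-++ E D R) ⟩
      sumℕ E (R ∘ toℕ) ℕ.+ sumℕ D (λ i → R (E ℕ.+ toℕ i)) ℕ.+ D ℕ.* E                   ≡⟨ ℕₚ.+-assoc (sumℕ E (R ∘ toℕ)) _ _ ⟩
      sumℕ E (R ∘ toℕ) ℕ.+ (sumℕ D (λ i → R (E ℕ.+ toℕ i)) ℕ.+ D ℕ.* E)                 ≤⟨ ℕₚ.+-mono-≤ (sumℕ-mono-≤ E (R≤earliest ∘ toℕ)) (sumℕ-gap D E (long-gap ∘ toℕ)) ⟩
      sumℕ E (earliest ∘ toℕ) ℕ.+ sumℕ D (λ i → earliest (E ℕ.+ toℕ i))                 ≡⟨ sumℕ-++ E D earliest ⟨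
      sumℕ (E ℕ.+ D) (earliest ∘ toℕ)                                                   ≡⟨ cong (λ k → sumℕ k (earliest ∘ toℕ)) Π≡ ⟨
      QΠ                                                                                ∎
      where open ℕₚ.≤-Reasoning

  cost≥ : ℕtoℚ (D ℕ.* E) ≤ cost schedule
  cost≥ = subst (ℕtoℚ (D ℕ.* E) ≤_) (sym (schedule-cost R≤earliest tight)) optimum≥

  Fw≡ : F w ≡ 2 ℕ.^ D
  Fw≡ = F-shift N

  -- The ratio is exactly 2^D: the smallest selected size is that of a unit job, and the largest is
  -- that of job `w`. The sizes above 2^D belong to unselected jobs.
  schedule-logRatio : LogRatio schedule D
  schedule-logRatio = Fin.zero , Fin.fromℕ w ↑ˡ D , refl , S-selected R≤earliest tight (Fin.fromℕ w) ,
    (λ j j∈ → subst (ℕ._≤ F (toℕ j)) (sym F₀≡) (F-pos (toℕ j)) ,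
              subst (λ k → F (toℕ j) ℕ.≤ F k) (sym toℕ-w) (F-mono (ℕ.s≤s⁻¹ (ℕₚ.<ᵇ⇒< (toℕ j) Π (Equivalence.from T-≡ j∈))))) ,
    subst₂ (λ a b → 2 ℕ.^ D ℕ.* a ℕ.≤ b) (sym F₀≡) (sym Fmax≡) (ℕₚ.≤-reflexive (ℕₚ.*-identityʳ (2 ℕ.^ D))) ,
    subst₂ (λ a b → b ℕ.< 2 ℕ.^ suc D ℕ.* a) (sym F₀≡) (sym Fmax≡)
      (subst (2 ℕ.^ D ℕ.<_) (sym (ℕₚ.*-identityʳ (2 ℕ.^ suc D))) (ℕₚ.^-monoʳ-< 2 (ℕ.s≤s (ℕ.s≤s ℕ.z≤n)) (ℕₚ.n<1+n D)))
    where
    F₀≡ : F 0 ≡ 1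
    F₀≡ = F-short 1≤E
    toℕ-w : toℕ (Fin.fromℕ w ↑ˡ D) ≡ w
    toℕ-w = trans (Finₚ.toℕ-↑ˡ (Fin.fromℕ w) D) (Finₚ.toℕ-fromℕ w)
    Fmax≡ : F (toℕ (Fin.fromℕ w ↑ˡ D)) ≡ 2 ℕ.^ D
    Fmax≡ = trans (cong F toℕ-w) Fw≡

  -- E until the unit jobs begin, E for the unit jobs, and at most 2^D, hence at most E, for the
  -- selected long jobs other than `w`.
  horizon : ℕ
  horizon = 3 ℕ.* E

  earliest≤horizon : earliest w ℕ.≤ horizon
  earliest≤horizon = ℕₚ.+-monoʳ-≤ E (begin
    before (E ℕ.+ N)                                              ≡⟨ sumℕ-++ E N F ⟩
    sumℕ E (F ∘ toℕ) ℕ.+ sumℕ N (λ i → F (E ℕ.+ toℕ i))           ≤⟨ ℕₚ.+-mono-≤ (sumℕ-mono-≤ E (λ i → ℕₚ.≤-reflexive (F-short (Finₚ.toℕ<n i))))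
                                                                       (sumℕ-mono-≤ N (λ i → ℕₚ.≤-reflexive (F-shift (toℕ i)))) ⟩
    sumℕ E (λ _ → 1) ℕ.+ sumℕ N (λ i → 2 ℕ.^ suc (toℕ i))         ≤⟨ ℕₚ.+-mono-≤ (ℕₚ.≤-reflexive (trans (sumℕ-const E 1) (ℕₚ.*-identityʳ E))) (sum-powers-≤ N) ⟩
    E ℕ.+ 2 ℕ.^ D                                                 ≤⟨ ℕₚ.+-monoʳ-≤ E (ℕₚ.≤-trans (ℕₚ.^-monoʳ-≤ 2 (ℕₚ.m≤m+n D D)) (ℕₚ.≤-reflexive (sym E≡))) ⟩
    E ℕ.+ E                                                       ≡⟨ cong (E ℕ.+_) (ℕₚ.+-identityʳ E) ⟨
    2 ℕ.* E                                                       ∎)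
    where open ℕₚ.≤-Reasoning

  schedule-completesBy : CompletesBy schedule horizon
  schedule-completesBy i = ℚₚ.≤-trans (schedule-completes R≤earliest tight i) (ℕtoℚ-mono-≤ {earliest w} {horizon} earliest≤horizon)

  -- Feasibility and value of the fractional solution

  h≤F : ∀ j → h j ℕ.≤ F j
  h≤F j = ℕₚ.^-monoʳ-≤ 2 (ℕₚ.∸-monoˡ-≤ E (ℕₚ.n≤1+n j))

  window≤horizon : ∀ {j} → j ℕ.< n → R j ℕ.+ h j ℕ.≤ suc horizon
  window≤horizon {j} j<n with ℕₚ.<-≤-connex j E
  ... | inj₁ j<E = begin
    R j ℕ.+ h j                 ≡⟨ cong₂ ℕ._+_ (R-short j<E) (h-short j<E) ⟩
    E ℕ.+ j ℕ.+ 1               ≡⟨ ℕₚ.+-comm (E ℕ.+ j) 1 ⟩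
    suc (E ℕ.+ j)               ≤⟨ ℕ.s≤s (ℕₚ.+-monoʳ-≤ E (ℕₚ.≤-trans (ℕₚ.<⇒≤ j<E) (ℕₚ.m≤m+n E _))) ⟩
    suc horizon                 ∎
    where open ℕₚ.≤-Reasoning
  ... | inj₂ E≤j = begin
    R j ℕ.+ h j                 ≤⟨ ℕₚ.+-monoʳ-≤ (R j) (h≤F j) ⟩
    R j ℕ.+ F j                 ≡⟨ R+F-long E≤j j<n ⟩
    E                           ≤⟨ ℕₚ.m≤m+n E _ ⟩
    horizon                     ≤⟨ ℕₚ.n≤1+n horizon ⟩
    suc horizon                 ∎
    where open ℕₚ.≤-Reasoning

  windows-exclusive-< : ∀ {i j t} → i ℕ.< j → j ℕ.< n → R i ℕ.≤ t → t ℕ.< R i ℕ.+ h i → R j ℕ.≤ t → ¬ (t ℕ.< R j ℕ.+ h j)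
  windows-exclusive-< {i} {j} {t} i<j j<n Ri≤t t<Ri+hi Rj≤t t<Rj+hj with ℕₚ.<-≤-connex j E | ℕₚ.<-≤-connex i E
  ... | inj₁ j<E | inj₁ i<E = ℕₚ.<⇒≱ t<Ri+hi (begin
    R i ℕ.+ h i                 ≡⟨ cong₂ ℕ._+_ (R-short i<E) (h-short i<E) ⟩
    E ℕ.+ i ℕ.+ 1               ≡⟨ ℕₚ.+-assoc E i 1 ⟩
    E ℕ.+ (i ℕ.+ 1)             ≤⟨ ℕₚ.+-monoʳ-≤ E (subst (ℕ._≤ j) (ℕₚ.+-comm 1 i) i<j) ⟩
    E ℕ.+ j                     ≡⟨ R-short j<E ⟨
    R j                         ≤⟨ Rj≤t ⟩
    t                           ∎)
    where open ℕₚ.≤-Reasoning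
  ... | inj₁ j<E | inj₂ E≤i = ℕₚ.<⇒≱ (ℕₚ.<-trans i<j j<E) E≤i
  -- A long window ends by E, before any unit job is released.
  ... | inj₂ E≤j | inj₁ i<E = ℕₚ.<⇒≱ t<Rj+hj (begin
    R j ℕ.+ h j                 ≤⟨ ℕₚ.+-monoʳ-≤ (R j) (h≤F j) ⟩
    R j ℕ.+ F j                 ≡⟨ R+F-long E≤j j<n ⟩
    E                           ≤⟨ ℕₚ.m≤m+n E i ⟩
    E ℕ.+ i                     ≡⟨ R-short i<E ⟨
    R i                         ≤⟨ Ri≤t ⟩
    t                           ∎)
    where open ℕₚ.≤-Reasoning
  -- The window of the longer job j ends at E - `h j`. The shorter job i has `F i` at most `h j`, so
  -- it is released at that time or later.
  ... | inj₂ E≤j | inj₂ E≤i = ℕₚ.<⇒≱ t<Rj+hj (ℕₚ.≤-trans (ℕₚ.+-cancelʳ-≤ (h j) (R j ℕ.+ h j) (R i) (begin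
    R j ℕ.+ h j ℕ.+ h j         ≡⟨ solve 2 (λ r h → r :+ h :+ h := r :+ con 2 :* h) refl (R j) (h j) ⟩
    R j ℕ.+ 2 ℕ.* h j           ≡⟨ cong (R j ℕ.+_) (F-long E≤j) ⟨
    R j ℕ.+ F j                 ≡⟨ R+F-long E≤j j<n ⟩
    E                           ≡⟨ R+F-long E≤i (ℕₚ.<-trans i<j j<n) ⟨
    R i ℕ.+ F i                 ≤⟨ ℕₚ.+-monoʳ-≤ (R i) (ℕₚ.^-monoʳ-≤ 2 (ℕₚ.∸-monoˡ-≤ E i<j)) ⟩
    R i ℕ.+ h j                 ∎)) Ri≤t)
    where open ℕₚ.≤-Reasoning
          open ℕ-Solver

  windows-exclusive : ∀ {i j t} → i ℕ.< n → j ℕ.< n → R i ℕ.≤ t × t ℕ.< R i ℕ.+ h i → R j ℕ.≤ t × t ℕ.< R j ℕ.+ h j → i ≡ j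
  windows-exclusive {i} {j} i<n j<n (Ri≤t , t<i) (Rj≤t , t<j) with ℕₚ.<-cmp i j
  ... | tri< i<j _ _ = contradiction t<j (windows-exclusive-< i<j j<n Ri≤t t<i Rj≤t)
  ... | tri≈ _ i≡j _ = i≡j
  ... | tri> _ _ j<i = contradiction t<i (windows-exclusive-< j<i i<n Rj≤t t<j Ri≤t)

  X : ℕ → ℕ → ℚ
  X j = window (R j) (h j)

  Y : ℕ → ℚ
  Y j = if j ℕ.<ᵇ E then 1ℚ else ½

  Y-short : ∀ {j} → j ℕ.< E → Y j ≡ 1ℚ
  Y-short {j} j<E = cong (if_then 1ℚ else ½) (dec-true (j ℕ.<? E) j<E)

  Y-long : ∀ {j} → E ℕ.≤ j → Y j ≡ ½
  Y-long {j} E≤j = cong (if_then 1ℚ else ½) (dec-false (j ℕ.<? E) (ℕₚ.≤⇒≯ E≤j))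

  term : ℕ → ℕ → ℚ
  term j t = X j t * inv-p̃ (F j) * ((ℕtoℚ t + ½) - ℕtoℚ (R j)) + X j t * ½

  lpPoint : LPPoint I horizon
  lpPoint = record
    { x = λ j t → X (toℕ j) (toℕ t)
    ; y = Y ∘ toℕ
    -- Taken to be the right-hand side of (1), so that `c1` holds by `refl`.
    ; f = λ j → sumℚ (suc horizon) (term (toℕ j) ∘ toℕ)
    }

  F*Y≡h : ∀ j → ℕtoℚ (F j) * Y j ≡ ℕtoℚ (h j)
  F*Y≡h j with ℕₚ.<-≤-connex j E
  ... | inj₁ j<E = trans (cong₂ (λ a b → ℕtoℚ a * b) (F-short j<E) (Y-short j<E)) (cong ℕtoℚ (sym (h-short j<E)))
  ... | inj₂ E≤j = begin
    ℕtoℚ (F j) * Y j               ≡⟨ cong₂ (λ a b → ℕtoℚ a * b) (F-long E≤j) (Y-long E≤j) ⟩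
    ℕtoℚ (2 ℕ.* h j) * ½           ≡⟨ cong (_* ½) (ℕtoℚ-homo-* 2 (h j)) ⟩
    ℕtoℚ 2 * ℕtoℚ (h j) * ½        ≡⟨ solve 1 (λ a → con (ℕtoℚ 2) :* a :* con ½ := a) refl (ℕtoℚ (h j)) ⟩
    ℕtoℚ (h j)                     ∎
    where open ≡-Reasoning
          open +-*-Solver

  -- The E unit jobs count fully and the 2D long jobs count half, which meets the demand E + D with
  -- equality.
  Y-total : sumℚ n (Y ∘ toℕ) ≡ ℕtoℚ Π
  Y-total = begin
    sumℚ n (Y ∘ toℕ)                                                  ≡⟨ cong (λ k → sumℚ k (Y ∘ toℕ)) n≡ ⟩
    sumℚ (E ℕ.+ (D ℕ.+ D)) (Y ∘ toℕ)                                  ≡⟨ sumℚ-++ E (D ℕ.+ D) Y ⟩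
    sumℚ E (Y ∘ toℕ) + sumℚ (D ℕ.+ D) (λ i → Y (E ℕ.+ toℕ i))         ≡⟨ cong₂ _+_ (sumℚ-cong E (λ i → Y-short (Finₚ.toℕ<n i))) (sumℚ-cong (D ℕ.+ D) (λ i → Y-long (ℕₚ.m≤m+n E (toℕ i)))) ⟩
    sumℚ E (λ _ → 1ℚ) + sumℚ (D ℕ.+ D) (λ _ → ½)                      ≡⟨ cong₂ _+_ (sumℚ-const E 1ℚ) (sumℚ-const (D ℕ.+ D) ½) ⟩
    ℕtoℚ E * 1ℚ + ℕtoℚ (D ℕ.+ D) * ½                                  ≡⟨ cong (λ z → ℕtoℚ E * 1ℚ + z * ½) (ℕtoℚ-homo-+ D D) ⟩
    ℕtoℚ E * 1ℚ + (ℕtoℚ D + ℕtoℚ D) * ½                               ≡⟨ solve 2 (λ e m → e :* con 1ℚ :+ (m :+ m) :* con ½ := e :+ m) refl (ℕtoℚ E) (ℕtoℚ D) ⟩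
    ℕtoℚ E + ℕtoℚ D                                                   ≡⟨ ℕtoℚ-homo-+ E D ⟨
    ℕtoℚ (E ℕ.+ D)                                                    ≡⟨ cong ℕtoℚ Π≡ ⟨
    ℕtoℚ Π                                                            ∎
    where open ≡-Reasoning
          open +-*-Solver

  capacity : ∀ t → sumℚ n (λ j → X (toℕ j) t) ≤ 1ℚ
  capacity t = sumℚ-exclusive n (λ j → does (inWindow? (R (toℕ j)) (h (toℕ j)) t)) (λ i j i∈ j∈ →
    Finₚ.toℕ-injective (windows-exclusive (Finₚ.toℕ<n i) (Finₚ.toℕ<n j) (does⇒ (inWindow? _ _ t) i∈) (does⇒ (inWindow? _ _ t) j∈)))

  lpPoint-feasible : LPFeasible lpPoint
  lpPoint-feasible = record
    { c1 = λ j → refl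
    ; c2 = λ j → trans (F*Y≡h (toℕ j)) (sym (window-sum (R (toℕ j)) (h (toℕ j)) (window≤horizon (Finₚ.toℕ<n j))))
    ; c3 = λ t → capacity (toℕ t)
    ; c4 = ℚₚ.≤-reflexive (sym Y-total)
    ; c5 = λ j t t<r → window-out {R (toℕ j)} {h (toℕ j)} {toℕ t} (λ (r≤t , _) → ℕₚ.<⇒≱ t<r r≤t)
    ; c6 = λ j t → 0≤indicator _
    ; c7 = λ j → Y-bounds (toℕ j)
    }
    where
    Y-bounds : ∀ j → (0ℚ ≤ Y j) × (Y j ≤ 1ℚ)
    Y-bounds j with j ℕ.<ᵇ E
    ... | true  = 0≤indicator true , ℚₚ.≤-refl
    ... | false = *≤* (ℤ.+≤+ ℕ.z≤n) , *≤* (ℤ.+≤+ (ℕ.s≤s ℕ.z≤n))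

  -- The 1 bounds the weighted age in `term`, and the ½ is the coefficient of its second summand.
  3/2 : ℚ
  3/2 = 1ℚ + ½

  -- A job is only processed while t + 1 ≤ r + p, so its fractional flow time per unit of volume is at most 1.
  term≤ : ∀ j t → term j t ≤ 3/2 * X j t
  term≤ j t with inWindow? (R j) (h j) t
  ... | no _ = ℚₚ.≤-reflexive (solve 2 (λ i g → con 0ℚ :* i :* g :+ con 0ℚ :* con ½ := con 3/2 :* con 0ℚ) refl
                 (inv-p̃ (F j)) ((ℕtoℚ t + ½) - ℕtoℚ (R j)))
    where open +-*-Solver
  ... | yes (R≤t , t<R+h) = begin
    -- The size is a power of 2 already, so rounding up does not change it and `inv-p̃` is its exact
    -- reciprocal.
    1ℚ * inv-p̃ (F j) * age + 1ℚ * ½               ≡⟨ cong (λ z → z * age + 1ℚ * ½) (trans (ℚₚ.*-identityˡ (inv-p̃ (F j))) (inv-p̃-2^ q)) ⟩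
    invPow2 q * age + 1ℚ * ½                      ≤⟨ ℚₚ.+-monoˡ-≤ (1ℚ * ½) (ℚₚ.*-monoˡ-≤-nonNeg (invPow2 q) {{invPow2-nonNeg q}} age≤) ⟩
    invPow2 q * ℕtoℚ (F j) + 1ℚ * ½               ≡⟨ cong (_+ 1ℚ * ½) (invPow2-inverse q) ⟩
    1ℚ + 1ℚ * ½                                   ≡⟨⟩
    3/2 * 1ℚ                                      ∎
    where
    open ℚₚ.≤-Reasoning
    q : ℕ
    q = suc j ℕ.∸ E
    age : ℚ
    age = (ℕtoℚ t + ½) - ℕtoℚ (R j)
    t+1≤ : ℕtoℚ t + 1ℚ ≤ ℕtoℚ (R j) + ℕtoℚ (F j)
    t+1≤ = subst₂ _≤_ (ℕtoℚ-homo-+ t 1) (ℕtoℚ-homo-+ (R j) (F j)) (ℕtoℚ-mono-≤ {t ℕ.+ 1} {R j ℕ.+ F j}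
      (subst (ℕ._≤ R j ℕ.+ F j) (ℕₚ.+-comm 1 t) (ℕₚ.<-≤-trans t<R+h (ℕₚ.+-monoʳ-≤ (R j) (h≤F j)))))
    age≤ : age ≤ ℕtoℚ (F j)
    age≤ = subst (age ≤_) (solve 2 (λ r f → r :+ f :- r := f) refl (ℕtoℚ (R j)) (ℕtoℚ (F j)))
      (ℚₚ.+-monoˡ-≤ (- ℕtoℚ (R j)) (ℚₚ.≤-trans (ℚₚ.+-monoʳ-≤ (ℕtoℚ t) ½≤1) t+1≤))
      where
      open +-*-Solver
      ½≤1 : ½ ≤ 1ℚ
      ½≤1 = *≤* (ℤ.+≤+ (ℕ.s≤s ℕ.z≤n))

  -- Exchanging the sums lets the capacity bound act slot by slot: each slot costs at most 3/2, and
  -- there are 3E + 1 slots, at most 4E.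
  objective≤ : LPobjective lpPoint ≤ 3/2 * ℕtoℚ (4 ℕ.* E)
  objective≤ = begin
    sumℚ n (λ j → sumℚ m (λ t → term (toℕ j) (toℕ t)))              ≤⟨ sumℚ-mono-≤ n (λ j → sumℚ-mono-≤ m (λ t → term≤ (toℕ j) (toℕ t))) ⟩
    sumℚ n (λ j → sumℚ m (λ t → 3/2 * X (toℕ j) (toℕ t)))           ≡⟨ sumℚ-swap n m (λ j t → 3/2 * X (toℕ j) (toℕ t)) ⟩
    sumℚ m (λ t → sumℚ n (λ j → 3/2 * X (toℕ j) (toℕ t)))           ≡⟨ sumℚ-cong m (λ t → sumℚ-*ˡ n 3/2 (λ j → X (toℕ j) (toℕ t))) ⟩
    sumℚ m (λ t → 3/2 * sumℚ n (λ j → X (toℕ j) (toℕ t)))           ≤⟨ sumℚ-mono-≤ m (λ t → ℚₚ.*-monoˡ-≤-nonNeg 3/2 (capacity (toℕ t))) ⟩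
    sumℚ m (λ _ → 3/2 * 1ℚ)                                         ≡⟨ sumℚ-const m (3/2 * 1ℚ) ⟩
    ℕtoℚ m * (3/2 * 1ℚ)                                             ≡⟨ ℚₚ.*-comm (ℕtoℚ m) 3/2 ⟩
    3/2 * ℕtoℚ m                                                    ≤⟨ ℚₚ.*-monoˡ-≤-nonNeg 3/2 (ℕtoℚ-mono-≤ {m} {4 ℕ.* E} (ℕₚ.+-monoˡ-≤ (3 ℕ.* E) 1≤E)) ⟩
    3/2 * ℕtoℚ (4 ℕ.* E)                                            ∎
    where
    open ℚₚ.≤-Reasoning
    m = suc horizon

-- Ratio of the integral and the fractional cost

1/6 : ℚ
1/6 = ℤ.+ 1 / 6

integrality-gap : ∀ N → let open Gap N (2 ℕ.^ (suc N ℕ.+ suc N)) refl in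
                  1/6 * ℕtoℚ (suc N) * LPobjective lpPoint ≤ cost schedule
integrality-gap N = begin
  1/6 * ℕtoℚ D * LPobjective lpPoint               ≤⟨ ℚₚ.*-monoˡ-≤-nonNeg (1/6 * ℕtoℚ D) {{c≥0}} objective≤ ⟩
  1/6 * ℕtoℚ D * (3/2 * ℕtoℚ (4 ℕ.* E))            ≡⟨ cong (λ z → 1/6 * ℕtoℚ D * (3/2 * z)) (ℕtoℚ-homo-* 4 E) ⟩
  -- The constant 1/6 cancels the factor 3/2 times 4 from the bound on the objective.
  1/6 * ℕtoℚ D * (3/2 * (ℕtoℚ 4 * ℕtoℚ E))         ≡⟨ solve 2 (λ d e → con 1/6 :* d :* (con 3/2 :* (con (ℕtoℚ 4) :* e)) := d :* e) refl (ℕtoℚ D) (ℕtoℚ E) ⟩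
  ℕtoℚ D * ℕtoℚ E                                  ≡⟨ ℕtoℚ-homo-* D E ⟨
  ℕtoℚ (D ℕ.* E)                                   ≤⟨ cost≥ ⟩
  cost schedule                                    ∎
  where
  E = 2 ℕ.^ (suc N ℕ.+ suc N)
  open Gap N E refl
  open ℚₚ.≤-Reasoning
  open +-*-Solver
  c≥0 : NonNegative (1/6 * ℕtoℚ D)
  c≥0 = ℚₚ.nonNeg*nonNeg⇒nonNeg 1/6 (ℕtoℚ D) {{nonNegative (0≤ℕtoℚ D)}}

-- Any feasible point bounds Opt(LP) from above, so comparing the optimal cost with its objective
-- gives the gap. Since k is at least the arbitrary N, the ratio of the two optima is unbounded over
-- the family.
theorem4p2 : ∃[ c ] (0ℚ < c) × (∀ (N : ℕ) →
    ∃[ I ] ∃[ σ ] Optimal {I} σ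
    × ∃[ k ] (N ℕ.≤ k) × LogRatio σ k
    × ∃[ T ] CompletesBy σ T
    × ∃[ sol ] LPFeasible {I} {T} sol
    × (c * ℕtoℚ k * LPobjective sol ≤ cost σ))
theorem4p2 = 1/6 , *<* (ℤ.+<+ (ℕ.s≤s ℕ.z≤n)) , λ N →
  let open Gap N (2 ℕ.^ (suc N ℕ.+ suc N)) refl in
  I , schedule , schedule-optimal , suc N , ℕₚ.n≤1+n N , schedule-logRatio ,
  horizon , schedule-completesBy , lpPoint , lpPoint-feasible , integrality-gap N
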